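{- Let $f$ be a $q$-polynomial over $\mathbb{F}_{q^n}$ and let $V=\{(x,\mathrm{Tr}_{q^n/q}(x)) \colon x\in \mathbb{F}_{q^n}\}$. Then $L_{U_f}=L_V$ if and only if $\lambda U_f=V$ for some $\lambda\in \mathbb{F}_{q^n}^*$. In particular, the linear set $L_V$ is simple.
   Context: $q$ is a prime power, $n\ge 2$, $\mathrm{Tr}_{q^n/q}(x)=x+x^q+\dots+x^{q^{n-1}}$. For an $\mathbb{F}_q$-subspace $U$ of $W=\mathbb{F}_{q^n}^2$, $L_U=\{\langle \mathbf{u}\rangle_{\mathbb{F}_{q^n}} \colon \mathbf{u}\in U\setminus\{\mathbf{0}\}\}\subseteq\mathrm{PG}(1,q^n)$; for a $q$-polynomial $h$ over $\mathbb{F}_{q^n}$, $U_h=\{(x,h(x))\colon x\in\mathbb{F}_{q^n}\}$. A linear set $L$ is $\mathbb{F}_{q^t}$-linear if $L=L_{U'}$ for an $\mathbb{F}_{q^t}$-subspace $U'$ of $W$, and its maximum field of linearity is $\mathbb{F}_{q^t}$ for the largest such $t$. An $\mathbb{F}_q$-linear set $L_U$ with maximum field of linearity $\mathbb{F}_q$ is called simple if for every $\mathbb{F}_q$-subspace $V'$ of $W$ with $\dim_{\mathbb{F}_q}V'=\dim_{\mathbb{F}_q}U$ and $L_{V'}=L_U$ there exists $g\in\mathrm{\Gamma L}(W,\mathbb{F}_{q^n})$ with $U^g=V'$. -}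

module Defs where

open import Level using (0ℓ)
open import Data.Nat as ℕ using (ℕ; zero; suc; _≤_; _<_)
open import Data.Nat.Divisibility using (_∣_)
open import Data.Nat.Primality using (Prime)
open import Data.Fin using (Fin)
import Data.Fin
open import Data.Product using (Σ; ∃; ∃-syntax; _×_; _,_)
open import Relation.Binary.PropositionalEquality using (_≡_; _≢_)
open import Relation.Nullary using (¬_)
open import Function.Bundles using (_↔_)
open import Algebra.Structures using (IsCommutativeRing)

IsPrimePower : ℕ → Set
IsPrimePower q = Σ ℕ λ p → Σ ℕ λ k → Prime p × 1 ≤ k × q ≡ p ℕ.^ k

record FiniteField : Set₁ where
  infixl 6 _+_
  infixl 7 _*_
  field
    Carrier : Set
    _+_ _*_ : Carrier → Carrier → Carrier
    -_      : Carrier → Carrier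
    0# 1#   : Carrier
    isCommutativeRing : IsCommutativeRing _≡_ _+_ _*_ -_ 0# 1#
    0≢1     : 0# ≢ 1#
    inverse : ∀ x → x ≢ 0# → Σ Carrier λ y → x * y ≡ 1#
    card    : ℕ
    enum    : Carrier ↔ Fin card

module _ (F : FiniteField) (q n : ℕ) where
  open FiniteField F

  pow : Carrier → ℕ → Carrier
  pow x zero    = 1#
  pow x (suc k) = x * pow x k

  sumF : (m : ℕ) → (Fin m → Carrier) → Carrier
  sumF zero    g = 0#
  sumF (suc m) g = g Data.Fin.zero + sumF m (λ i → g (Data.Fin.suc i))

  Tr : Carrier → Carrier
  Tr x = sumF n (λ i → pow x (q ℕ.^ Data.Fin.toℕ i))

  evalQPoly : (Fin n → Carrier) → Carrier → Carrier
  evalQPoly a x = sumF n (λ i → a i * pow x (q ℕ.^ Data.Fin.toℕ i))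

  InSubfield : ℕ → Carrier → Set
  InSubfield t c = pow c (q ℕ.^ t) ≡ c

  W : Set
  W = Carrier × Carrier

  0W : W
  0W = 0# , 0#

  _⊕_ : W → W → W
  (a , b) ⊕ (c , d) = (a + c) , (b + d)

  _•_ : Carrier → W → W
  μ • (a , b) = (μ * a) , (μ * b)

  SubsetW : Set₁
  SubsetW = W → Set

  graph : (Carrier → Carrier) → SubsetW
  graph h w = Σ Carrier λ x → w ≡ (x , h x)

  -- L_U ⊆ L_V : every point <u> (u ∈ U \ {0}) equals some point <v> (v ∈ V \ {0})
  LinSetSub : SubsetW → SubsetW → Set
  LinSetSub U V = ∀ u → U u → u ≢ 0W →
    Σ W λ v → V v × v ≢ 0W × Σ Carrier λ μ → u ≡ μ • v

  LinSetEq : SubsetW → SubsetW → Set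
  LinSetEq U V = LinSetSub U V × LinSetSub V U

  ScaledEq : Carrier → SubsetW → SubsetW → Set
  ScaledEq λ' U V = (∀ u → U u → V (λ' • u)) × (∀ v → V v → Σ W λ u → U u × λ' • u ≡ v)

  IsSubspace : ℕ → SubsetW → Set
  IsSubspace t U = U 0W × (∀ u v → U u → U v → U (u ⊕ v))
                 × (∀ c u → InSubfield t c → U u → U (c • u))

  lincomb : (d : ℕ) → (Fin d → Carrier) → (Fin d → W) → W
  lincomb zero    c b = 0W
  lincomb (suc d) c b = (c Data.Fin.zero • b Data.Fin.zero)
                          ⊕ lincomb d (λ i → c (Data.Fin.suc i)) (λ i → b (Data.Fin.suc i))

  HasDim : SubsetW → ℕ → Set
  HasDim U d = Σ (Fin d → W) λ b →
      (∀ i → U (b i))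
    × (∀ (c : Fin d → Carrier) → (∀ i → InSubfield 1 (c i)) → lincomb d c b ≡ 0W → ∀ i → c i ≡ 0#)
    × (∀ u → U u → Σ (Fin d → Carrier) λ c → (∀ i → InSubfield 1 (c i)) × u ≡ lincomb d c b)

  -- L_U has maximum field of linearity F_q: not F_{q^t}-linear for any t > 1, t ∣ n
  MaxFieldFq : SubsetW → Set₁
  MaxFieldFq U = ∀ t → 1 < t → t ∣ n → ¬ (Σ SubsetW λ U' → IsSubspace t U' × LinSetEq U' U)

  IsFieldAut : (Carrier → Carrier) → Set
  IsFieldAut σ = (∀ x y → σ (x + y) ≡ σ x + σ y) × (∀ x y → σ (x * y) ≡ σ x * σ y)
               × σ 1# ≡ 1# × (∀ x y → σ x ≡ σ y → x ≡ y) × (∀ y → Σ Carrier λ x → σ x ≡ y)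

  record ΓL : Set where
    field
      σ : Carrier → Carrier
      σ-aut : IsFieldAut σ
      a b c d : Carrier
      det≢0 : (a * d) + (- (b * c)) ≢ 0#

  applyΓL : ΓL → W → W
  applyΓL g (x , y) = ((a * σ x) + (b * σ y)) , ((c * σ x) + (d * σ y))
    where open ΓL g

  ImageEq : ΓL → SubsetW → SubsetW → Set
  ImageEq g U V' = (∀ u → U u → V' (applyΓL g u)) × (∀ v → V' v → Σ W λ u → U u × applyΓL g u ≡ v)

  IsSimple : SubsetW → Set₁
  IsSimple U = IsSubspace 1 U × MaxFieldFq U ×
    (∀ (V' : SubsetW) (k : ℕ) → IsSubspace 1 V' → HasDim V' k → HasDim U k → LinSetEq V' U →
       Σ ΓL λ g → ImageEq g U V')

{-# OPTIONS --safe #-}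
module Submission where

open import Algebra.Bundles using (CommutativeMonoid; CommutativeRing; RawRing)
import Algebra.Properties.AbelianGroup as AbelianGroupProperties
import Algebra.Properties.CommutativeMonoid.Sum as MonoidSum
import Algebra.Properties.CommutativeSemiring.Binomial as Binomial
import Algebra.Properties.CommutativeSemiring.Exp as CommutativeExp
import Algebra.Properties.Group as GroupProperties
import Algebra.Properties.Ring as RingProperties
import Algebra.Properties.Semiring.Exp as Exp
import Algebra.Properties.Semiring.Mult as Multiples
import Algebra.Properties.Semiring.Mult.TCOptimised as OptimisedMultiples
import Algebra.Properties.Semiring.Sum as SemiringSum
import Algebra.Solver.Ring as RingSolver
open import Algebra.Solver.Ring.AlmostCommutativeRing using (fromCommutativeRing; _-Raw-AlmostCommutative⟶_)
open import Data.Fin using (Fin; zero; suc; toℕ; fromℕ; inject≤)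
open import Data.Fin.Permutation using (permutation)
import Data.Fin.Properties as Fin
open import Data.Integer as ℤ using (ℤ; +_; -[1+_]; _⊖_)
import Data.Integer.Properties as ℤ
open import Data.List using (List; []; _∷_)
open import Data.List.Relation.Unary.All using (All; []; _∷_)
open import Data.Maybe using (Maybe; just; nothing)
open import Data.Nat as ℕ using (ℕ; zero; suc; _≤_; _!; _∸_)
open import Data.Nat.Combinatorics using (_C_; nCn≡1; k![n∸k]!∣n!)
open import Data.Nat.Combinatorics.Specification using (nCk≡n!/k![n-k]!)
open import Data.Nat.DivMod using (m/n*n≡m)
open import Data.Nat.Divisibility using (_∣_; divides; ∣⇒≤; m∣m*n)
open import Data.Nat.Primality using (Prime; euclidsLemma; prime⇒nonTrivial)
import Data.Nat.Properties as ℕ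
open import Data.Product using (Σ; ∃; _×_; _,_; proj₁; proj₂)
import Data.Sign as Sign
open import Data.Sum using (_⊎_; inj₁; inj₂)
open import Data.Unit using (⊤; tt)
open import Data.Vec using (Vec; []; _∷_; zipWith; map; replicate)
open import Function using (_∘_; id)
open import Function.Bundles using (Inverse; _⇔_; mk⇔)
open import Level using (0ℓ)
open import Relation.Binary.PropositionalEquality
open import Relation.Nullary using (¬_; Dec; yes; no; contradiction)
open import Relation.Nullary.Decidable as Dec using (_×-dec_; ¬?; decidable-stable)

open import Defs

-- Let T = Tr and let f be F_q-linear with L_{U_f} = L_V. Then T(x / f x) = 1 whenever
-- f x ≠ 0, and every z with T z = 1 is of the form x / f x. Replacing x by x + k with
-- k ∈ ker f shows that 1/e ⊥ ker f for all nonzero e in I = im f, so, by dimensions,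
-- the inverses of I form the additive group (ker f)^⊥. Scale f so that 1 ∈ I; Hua's
-- identity then makes I a subfield E with (ker f)^⊥ = E, hence E · ker f = ker f.
-- For z ranging over {T = 1} modulo ker f, the nonzero solutions e of f(ze) = e
-- partition E*, and each solution set is a nonzero subgroup without 0, so in
-- characteristic p the number of classes is 1. But this number is divisible by p
-- unless ker T ⊆ ker f, which therefore holds and gives f = T.

-- The sizes of `ker f` and of E stay unknown throughout, so the decisive count is made modulo p. It
-- takes place in F itself, as a sum of indicators: a set stable under a single nonzero translation
-- has sum 0 there, and no cardinality of E or of a solution set has to be computed. The relation E
-- · ker f = ker f enters because it lets E act on F / ker f; only then does f(ze) = e depend on the
-- class of z alone.
--
-- Hua's identity yields aba, not ab. Passing from one to the other depends on the parity of |F|: an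
-- even exponent is available when |F| is even, and 2 is invertible when |F| is odd.
--
-- The scaling is x ↦ f(βx)/β for a nonzero value β of f. Scaling argument and value by the same
-- factor keeps every slope, and undoing it gives λ = 1/β.
--
-- For simplicity of L_V, the point ⟨(0,1)⟩ is off L_V, so a competing subspace of the right
-- dimension is again a graph.

-- The unique ring homomorphism out of ℤ: with integer coefficients the ring
-- solver can decide that coefficients cancel, which it cannot do in F itself.
module IntegerCoefficients (F : FiniteField) where
  commutativeRing : CommutativeRing 0ℓ 0ℓ
  commutativeRing = record { isCommutativeRing = FiniteField.isCommutativeRing F }

  open CommutativeRing commutativeRing hiding (refl; sym; trans)
  open RingProperties ring using (-‿distribˡ-*; -‿distribʳ-*)
  open AbelianGroupProperties +-abelianGroup using (⁻¹-∙-comm)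
  open GroupProperties +-group using (⁻¹-involutive; ε⁻¹≈ε)
  open OptimisedMultiples semiring using (1+×; ×-homo-+; ×1-homo-*) renaming (_×_ to _×′_)
  open ≡-Reasoning

  -- With the optimised multiples `natural 1` reduces to `1#`, so that `con (+ 1)` in a solver
  -- equation denotes literally `1#`, not `1# + 0#`.
  natural : ℕ → Carrier
  natural n = n ×′ 1#

  integer : ℤ → Carrier
  integer (+ n)      = natural n
  integer (-[1+ n ]) = - natural (suc n)

  integer-⊖ : ∀ m n → integer (m ⊖ n) ≡ natural m + - natural n
  integer-⊖ m zero = begin
    natural m              ≡⟨ +-identityʳ _ ⟨
    natural m + 0#         ≡⟨ cong (λ t → natural m + t) (ε⁻¹≈ε) ⟨
    natural m + - 0#       ∎
  integer-⊖ zero (suc n) = sym (+-identityˡ _)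
  integer-⊖ (suc m) (suc n) = begin
    integer (suc m ⊖ suc n)                    ≡⟨ cong integer (ℤ.[1+m]⊖[1+n]≡m⊖n m n) ⟩
    integer (m ⊖ n)                            ≡⟨ integer-⊖ m n ⟩
    natural m + - natural n                      ≡⟨ +-identityˡ _ ⟨
    0# + (natural m + - natural n)               ≡⟨ cong (λ t → t + (natural m + - natural n)) (-‿inverseʳ 1#) ⟨
    (1# + - 1#) + (natural m + - natural n)      ≡⟨ +-assoc _ _ _ ⟩
    1# + (- 1# + (natural m + - natural n))      ≡⟨ cong (λ t → 1# + t) (+-assoc _ _ _) ⟨
    1# + ((- 1# + natural m) + - natural n)      ≡⟨ cong (λ t → 1# + (t + - natural n)) (+-comm _ _) ⟩
    1# + ((natural m + - 1#) + - natural n)      ≡⟨ cong (λ t → 1# + t) (+-assoc _ _ _) ⟩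
    1# + (natural m + (- 1# + - natural n))      ≡⟨ +-assoc _ _ _ ⟨
    (1# + natural m) + (- 1# + - natural n)      ≡⟨ cong₂ _+_ (sym (1+× m 1#)) (⁻¹-∙-comm _ _) ⟩
    natural (suc m) + - (1# + natural n)         ≡⟨ cong (λ t → natural (suc m) + - t) (1+× n 1#) ⟨
    natural (suc m) + - natural (suc n)          ∎

  integer-+ : ∀ i j → integer (i ℤ.+ j) ≡ integer i + integer j
  integer-+ (+ m) (+ n) = ×-homo-+ 1# m n
  integer-+ (+ m) (-[1+ n ]) = integer-⊖ m (suc n)
  integer-+ (-[1+ m ]) (+ n) = trans (integer-⊖ n (suc m)) (+-comm _ _)
  integer-+ (-[1+ m ]) (-[1+ n ]) = begin
    - natural (suc (suc (m ℕ.+ n)))         ≡⟨ cong (λ k → - natural (suc k)) (ℕ.+-suc m n) ⟨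
    - natural (suc m ℕ.+ suc n)             ≡⟨ cong -_ (×-homo-+ 1# (suc m) (suc n)) ⟩
    - (natural (suc m) + natural (suc n))     ≡⟨ ⁻¹-∙-comm _ _ ⟨
    - natural (suc m) + - natural (suc n)     ∎

  integer-neg : ∀ i → integer (ℤ.- i) ≡ - integer i
  integer-neg (+ zero)  = sym (ε⁻¹≈ε)
  integer-neg (+ suc n) = refl
  integer-neg (-[1+ n ]) = sym (⁻¹-involutive _)

  integer-* : ∀ i j → integer (i ℤ.* j) ≡ integer i * integer j
  integer-* (+ m) (+ n) = trans (cong integer (ℤ.+◃n≡+n (m ℕ.* n))) (×1-homo-* m n)
  integer-* (+ m) (-[1+ n ]) = begin
    integer (Sign.- ℤ.◃ (m ℕ.* suc n))   ≡⟨ cong integer (ℤ.-◃n≡-n (m ℕ.* suc n)) ⟩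
    integer (ℤ.- (+ (m ℕ.* suc n)))      ≡⟨ integer-neg (+ (m ℕ.* suc n)) ⟩
    - natural (m ℕ.* suc n)              ≡⟨ cong -_ (×1-homo-* m (suc n)) ⟩
    - (natural m * natural (suc n))        ≡⟨ -‿distribʳ-* _ _ ⟩
    natural m * - natural (suc n)          ∎
  integer-* (-[1+ m ]) (+ n) = begin
    integer (Sign.- ℤ.◃ (suc m ℕ.* n))   ≡⟨ cong integer (ℤ.-◃n≡-n (suc m ℕ.* n)) ⟩
    integer (ℤ.- (+ (suc m ℕ.* n)))      ≡⟨ integer-neg (+ (suc m ℕ.* n)) ⟩
    - natural (suc m ℕ.* n)              ≡⟨ cong -_ (×1-homo-* (suc m) n) ⟩
    - (natural (suc m) * natural n)        ≡⟨ -‿distribˡ-* _ _ ⟩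
    - natural (suc m) * natural n          ∎
  integer-* (-[1+ m ]) (-[1+ n ]) = begin
    natural (suc m ℕ.* suc n)                ≡⟨ ×1-homo-* (suc m) (suc n) ⟩
    natural (suc m) * natural (suc n)          ≡⟨ ⁻¹-involutive _ ⟨
    - - (natural (suc m) * natural (suc n))    ≡⟨ cong -_ (-‿distribˡ-* _ _) ⟩
    - (- natural (suc m) * natural (suc n))    ≡⟨ -‿distribʳ-* _ _ ⟩
    - natural (suc m) * - natural (suc n)      ∎

  ℤ-rawRing : RawRing 0ℓ 0ℓ
  ℤ-rawRing = record
    { Carrier = ℤ ; _≈_ = _≡_ ; _+_ = ℤ._+_ ; _*_ = ℤ._*_ ; -_ = ℤ.-_ ; 0# = + 0 ; 1# = + 1 }

  morphism : ℤ-rawRing -Raw-AlmostCommutative⟶ fromCommutativeRing commutativeRing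
  morphism = record
    { ⟦_⟧    = integer
    ; +-homo = integer-+
    ; *-homo = integer-*
    ; -‿homo = integer-neg
    ; 0-homo = refl
    ; 1-homo = refl
    }

  coefficients≟ : ∀ i j → Maybe (integer i ≡ integer j)
  coefficients≟ i j with i ℤ.≟ j
  ... | yes refl = just refl
  ... | no _     = nothing

  module Solver = RingSolver ℤ-rawRing (fromCommutativeRing commutativeRing) morphism coefficients≟

-- Finiteness, division and sums over all elements of F.

module FieldTheory (F : FiniteField) where
  open FiniteField F public
  open Inverse enum public using () renaming (to to index; from to element)

  open IntegerCoefficients F using (commutativeRing; module Solver) public
  open CommutativeRing commutativeRing public
    using (_-_; +-assoc; +-comm; +-identityˡ; +-identityʳ; -‿inverseʳ
          ; *-assoc; *-comm; *-identityˡ; *-identityʳ; distribˡ; distribʳ; zeroˡ; zeroʳ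
          ; +-commutativeMonoid; *-commutativeMonoid; +-group; ring; semiring; commutativeSemiring)

  open Solver public using (solve; _:=_; _:+_; _:*_; _:-_; :-_; con)

  open RingProperties ring public using (-‿distribˡ-*; -‿distribʳ-*)
  open GroupProperties +-group public using () renaming (x∙y⁻¹≈ε⇒x≈y to x-y≡0⇒x≡y)

  index-element : ∀ i → index (element i) ≡ i
  index-element = Inverse.strictlyInverseˡ enum

  element-index : ∀ x → element (index x) ≡ x
  element-index = Inverse.strictlyInverseʳ enum

  index-injective : ∀ {x y} → index x ≡ index y → x ≡ y
  index-injective {x} {y} eq = trans (sym (element-index x)) (trans (cong element eq) (element-index y))

  element-injective : ∀ {i j} → element i ≡ element j → i ≡ j
  element-injective {i} {j} eq = trans (sym (index-element i)) (trans (cong index eq) (index-element j))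

  infix 4 _≟_
  _≟_ : (x y : Carrier) → Dec (x ≡ y)
  x ≟ y = Dec.map′ index-injective (cong index) (index x Fin.≟ index y)

  any? : {P : Carrier → Set} → (∀ x → Dec (P x)) → Dec (∃ P)
  any? {P} P? = Dec.map′ (λ (i , p) → element i , p)
    (λ (x , p) → index x , subst P (sym (element-index x)) p)
    (Fin.any? (λ i → P? (element i)))

  abstract
    -- Pigeonhole: a missed value `y`, listed in front of all values of `g`, would give an injection
    -- of `Fin (suc card)` into `Fin card`.
    injective⇒surjective : (g : Carrier → Carrier) → (∀ x y → g x ≡ g y → x ≡ y) →
      ∀ y → ∃ λ x → g x ≡ y
    injective⇒surjective g g-inj y with any? (λ x → g x ≟ y)
    ... | yes p = p
    ... | no ¬p = contradiction (Fin.injective⇒≤ {f = h} h-injective) ℕ.1+n≰n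
      where
      h : Fin (suc card) → Fin card
      h zero    = index y
      h (suc i) = index (g (element i))
      h-injective : ∀ {i j} → h i ≡ h j → i ≡ j
      h-injective {zero}  {zero}  eq = refl
      h-injective {zero}  {suc j} eq = contradiction (element j , sym (index-injective eq)) ¬p
      h-injective {suc i} {zero}  eq = contradiction (element i , index-injective eq) ¬p
      h-injective {suc i} {suc j} eq = cong suc (element-injective (g-inj _ _ (index-injective eq)))

  abstract
    -- Extended by `inv 0# = 0#`, inversion is an involution of all of F, hence injective without
    -- side conditions.
    inv : Carrier → Carrier
    inv x with x ≟ 0#
    ... | yes _  = 0#
    ... | no x≢0 = proj₁ (inverse x x≢0)

    inv-zero : inv 0# ≡ 0#
    inv-zero with 0# ≟ 0#
    ... | yes _  = refl
    ... | no 0≢0 = contradiction refl 0≢0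

    *-inv : ∀ {x} → x ≢ 0# → x * inv x ≡ 1#
    *-inv {x} x≢0 with x ≟ 0#
    ... | yes x≡0 = contradiction x≡0 x≢0
    ... | no x≢0′ = proj₂ (inverse x x≢0′)

  inv-* : ∀ {x} → x ≢ 0# → inv x * x ≡ 1#
  inv-* x≢0 = trans (*-comm _ _) (*-inv x≢0)

  *≡1⇒≢0 : ∀ {x y} → x * y ≡ 1# → x ≢ 0#
  *≡1⇒≢0 {y = y} eq refl = 0≢1 (trans (sym (zeroˡ y)) eq)

  *-cancelˡ : ∀ {a x y} → a ≢ 0# → a * x ≡ a * y → x ≡ y
  *-cancelˡ {a} {x} {y} a≢0 eq = begin
    x                 ≡⟨ *-identityˡ x ⟨
    1# * x            ≡⟨ cong (_* x) (inv-* a≢0) ⟨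
    inv a * a * x     ≡⟨ *-assoc _ _ _ ⟩
    inv a * (a * x)   ≡⟨ cong (inv a *_) eq ⟩
    inv a * (a * y)   ≡⟨ *-assoc _ _ _ ⟨
    inv a * a * y     ≡⟨ cong (_* y) (inv-* a≢0) ⟩
    1# * y            ≡⟨ *-identityˡ y ⟩
    y                 ∎
    where open ≡-Reasoning

  *-≢0 : ∀ {a b} → a ≢ 0# → b ≢ 0# → a * b ≢ 0#
  *-≢0 {a} a≢0 b≢0 eq = b≢0 (*-cancelˡ a≢0 (trans eq (sym (zeroʳ a))))

  inv-unique : ∀ {x y} → x * y ≡ 1# → inv x ≡ y
  inv-unique eq = *-cancelˡ (*≡1⇒≢0 eq) (trans (*-inv (*≡1⇒≢0 eq)) (sym eq))

  inv-≢0 : ∀ {x} → x ≢ 0# → inv x ≢ 0#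
  inv-≢0 x≢0 = *≡1⇒≢0 (inv-* x≢0)

  inv-involutive : ∀ x → inv (inv x) ≡ x
  inv-involutive x with x ≟ 0#
  ... | yes refl = trans (cong inv inv-zero) inv-zero
  ... | no x≢0   = inv-unique (inv-* x≢0)

  -- Over an arbitrary monoid because two instances occur: sums over F for counting, and products
  -- over F for `x^card≡x`.
  module Total (M : CommutativeMonoid 0ℓ 0ℓ) where
    open CommutativeMonoid M using (_≈_; _∙_; ε; ∙-congˡ; ∙-congʳ; identityˡ; identityʳ)
      renaming (Carrier to C; refl to ≈-refl; sym to ≈-sym; trans to ≈-trans; reflexive to ≈-reflexive)
    open MonoidSum M public using (sum; sum-cong-≋; sum-replicate; sum-replicate-zero)
    open MonoidSum M using (∑-distrib-+; ∑-comm; sum-permute)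

    total : (Carrier → C) → C
    total g = sum (λ i → g (element i))

    total-cong : ∀ {g h} → (∀ x → g x ≈ h x) → total g ≈ total h
    total-cong g≈h = sum-cong-≋ (λ i → g≈h (element i))

    total-∙ : ∀ g h → total (λ x → g x ∙ h x) ≈ total g ∙ total h
    total-∙ g h = ∑-distrib-+ (λ i → g (element i)) (λ i → h (element i))

    total-comm : ∀ (g : Carrier → Carrier → C) →
      total (λ x → total (λ y → g x y)) ≈ total (λ y → total (λ x → g x y))
    total-comm g = ∑-comm (λ i j → g (element i) (element j))

    total-ε : total (λ _ → ε) ≈ ε
    total-ε = sum-replicate-zero card

    total-reindex : ∀ g (φ ψ : Carrier → Carrier) → (∀ x → φ (ψ x) ≡ x) → (∀ x → ψ (φ x) ≡ x) →
      total g ≈ total (λ x → g (φ x))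
    total-reindex g φ ψ φψ ψφ = ≈-trans
      (sum-permute (λ i → g (element i)) (permutation (conj φ) (conj ψ) (conj-inverse φ ψ φψ) (conj-inverse ψ φ ψφ)))
      (sum-cong-≋ {card} (λ i → ≈-reflexive (cong g (element-index _))))
      where
      conj : (Carrier → Carrier) → Fin card → Fin card
      conj χ i = index (χ (element i))
      conj-inverse : ∀ χ ω → (∀ x → χ (ω x) ≡ x) → ∀ i → conj χ (conj ω i) ≡ i
      conj-inverse χ ω χω i = trans (cong (index ∘ χ) (element-index _))
        (trans (cong index (χω _)) (index-element i))

    sum-single : ∀ {n} (t : Fin n → C) i → (∀ j → j ≢ i → t j ≈ ε) → sum t ≈ t i
    sum-single {suc n} t zero t≈ε = ≈-trans
      (∙-congˡ (≈-trans (sum-cong-≋ (λ j → t≈ε (suc j) (λ ()))) (sum-replicate-zero n)))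
      (identityʳ (t zero))
    sum-single {suc n} t (suc i) t≈ε = ≈-trans
      (∙-congʳ (t≈ε zero (λ ())))
      (≈-trans (identityˡ _) (sum-single (λ j → t (suc j)) i (λ j j≢i → t≈ε (suc j) (j≢i ∘ Fin.suc-injective))))

    total-single : ∀ g a → (∀ x → x ≢ a → g x ≈ ε) → total g ≈ g a
    total-single g a g≈ε = ≈-trans
      (sum-single (λ i → g (element i)) (index a) (λ i i≢ → g≈ε (element i) (λ eq →
        i≢ (trans (sym (index-element i)) (cong index eq)))))
      (≈-reflexive (cong g (element-index a)))

-- Prime divisors of binomial coefficients.

prime∤! : ∀ {p m} → Prime p → m ℕ.< p → ¬ p ∣ m !
prime∤! {p} {zero} pr m<p p∣1 = ℕ.<⇒≱ (ℕ.nonTrivial⇒n>1 p ⦃ prime⇒nonTrivial pr ⦄) (∣⇒≤ p∣1)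
prime∤! {p} {suc m} pr m<p p∣ with euclidsLemma (suc m) (m !) pr p∣
... | inj₁ p∣1+m = ℕ.<⇒≱ m<p (∣⇒≤ p∣1+m)
... | inj₂ p∣m!  = prime∤! pr (ℕ.<-trans (ℕ.n<1+n m) m<p) p∣m!

-- The prime divides p! = C(p,k) · k! (p-k)!, but neither factorial on the right, as both are of
-- numbers below p.
prime∣C : ∀ {p k} → Prime p → 0 ℕ.< k → k ℕ.< p → p ∣ p C k
prime∣C {suc p} {k} pr 0<k k<p with euclidsLemma (suc p C k) (k ! ℕ.* (suc p ∸ k) !) pr p∣product
  where
  instance _ = k ℕ.!* (suc p ∸ k) !≢0
  p∣product : suc p ∣ (suc p C k) ℕ.* (k ! ℕ.* (suc p ∸ k) !)
  p∣product = subst (suc p ∣_)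
    (sym (trans (cong (ℕ._* (k ! ℕ.* (suc p ∸ k) !)) (nCk≡n!/k![n-k]! (ℕ.<⇒≤ k<p)))
                (m/n*n≡m (k![n∸k]!∣n! (ℕ.<⇒≤ k<p)))))
    (m∣m*n (p !))
... | inj₁ p∣C = p∣C
... | inj₂ p∣!! with euclidsLemma (k !) ((suc p ∸ k) !) pr p∣!!
...   | inj₁ p∣k! = contradiction p∣k! (prime∤! pr k<p)
...   | inj₂ p∣!  = contradiction p∣! (prime∤! pr (ℕ.∸-monoʳ-< 0<k (ℕ.<⇒≤ k<p)))

-- Counting modulo the characteristic, and the power maps of F.

module FieldPowers (F : FiniteField) where
  open FieldTheory F public
  open Exp semiring public using (_^_; ^-assocʳ)
  open CommutativeExp commutativeSemiring public using (^-distrib-*)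
  open Multiples semiring public using (×-homo-+; ×1-homo-*; ×-assoc-*) renaming (_×_ to _·_)
  open SemiringSum semiring using (*-distribʳ-sum)
  module Additive = Total +-commutativeMonoid
  module Multiplicative = Total *-commutativeMonoid
  open Additive public using (sum; total; total-cong; total-comm; total-single)

  -- The values lie in F, so the `total` of an indicator is the cardinality of a set modulo the
  -- characteristic.
  indicator : {A : Set} → Dec A → Carrier
  indicator (yes _) = 1#
  indicator (no _)  = 0#

  indicator-true : {A : Set} (d : Dec A) → A → indicator d ≡ 1#
  indicator-true (yes _) a = refl
  indicator-true (no ¬a) a = contradiction a ¬a

  indicator-false : {A : Set} (d : Dec A) → ¬ A → indicator d ≡ 0#
  indicator-false (yes a) ¬a = contradiction a ¬a
  indicator-false (no _)  ¬a = refl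

  indicator-cong : {A B : Set} (d : Dec A) (e : Dec B) → (A → B) → (B → A) → indicator d ≡ indicator e
  indicator-cong (yes a) e A⇒B B⇒A = sym (indicator-true e (A⇒B a))
  indicator-cong (no ¬a) e A⇒B B⇒A = sym (indicator-false e (λ b → ¬a (B⇒A b)))

  total-+ : ∀ g h → total (λ x → g x + h x) ≡ total g + total h
  total-+ = Additive.total-∙

  total-*ʳ : ∀ g a → total (λ x → g x * a) ≡ total g * a
  total-*ʳ g a = sym (*-distribʳ-sum a (λ i → g (element i)))

  -- Comparing ∑_{x ∈ P} x with ∑_{x ∈ P} (x + a) gives |P| a = 0.
  count-translation-invariant : {P : Carrier → Set} (P? : ∀ x → Dec (P x)) (a : Carrier) → a ≢ 0# →
    (∀ x → P x → P (x + a)) → (∀ x → P (x + a) → P x) → total (λ x → indicator (P? x)) ≡ 0#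
  count-translation-invariant P? a a≢0 up down = *-cancelˡ a≢0 (trans (*-comm a _) (trans count*a≡0 (sym (zeroʳ a))))
    where
    open ≡-Reasoning
    χ : Carrier → Carrier
    χ x = indicator (P? x)
    S : Carrier
    S = total (λ x → χ x * x)
    N : Carrier
    N = total χ
    shifted : S ≡ S + N * a
    shifted = begin
      S                                                                   ≡⟨ Additive.total-reindex (λ x → χ x * x) (_+ a) (_- a)
                                                                               (λ x → solve 2 (λ x a → x :- a :+ a := x) refl x a)
                                                                               (λ x → solve 2 (λ x a → x :+ a :- a := x) refl x a) ⟩
      total (λ x → χ (x + a) * (x + a))                      ≡⟨ total-cong (λ x → trans
                                                                               (cong (_* (x + a)) (indicator-cong (P? (x + a)) (P? x) (down x) (up x)))
                                                                               (distribˡ _ x a)) ⟩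
      total (λ x → χ x * x + χ x * a)           ≡⟨ total-+ (λ x → χ x * x) (λ x → χ x * a) ⟩
      S + total (λ x → χ x * a)                              ≡⟨ cong (λ t → S + t) (total-*ʳ χ a) ⟩
      S + N * a                                                           ∎
    count*a≡0 : N * a ≡ 0#
    count*a≡0 = begin
      N * a               ≡⟨ solve 2 (λ s t → t := s :+ t :- s) refl S (N * a) ⟩
      S + N * a - S       ≡⟨ cong (λ t → t - S) shifted ⟨
      S - S               ≡⟨ -‿inverseʳ S ⟩
      0#                  ∎

  -- F itself is stable under translation by `1#`.
  card·1≡0 : card · 1# ≡ 0#
  card·1≡0 = begin
    card · 1#                                ≡⟨ Additive.sum-replicate card ⟨
    total (λ _ → 1#)                         ≡⟨ count-translation-invariant (λ _ → yes tt) 1# (0≢1 ∘ sym) _ _ ⟩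
    0#                                       ∎
    where open ≡-Reasoning

  card·x≡0 : ∀ x → card · x ≡ 0#
  card·x≡0 x = begin
    card · x          ≡⟨ cong (card ·_) (*-identityˡ x) ⟨
    card · (1# * x)   ≡⟨ ×-assoc-* card 1# x ⟨
    (card · 1#) * x   ≡⟨ cong (_* x) card·1≡0 ⟩
    0# * x            ≡⟨ zeroˡ x ⟩
    0#                ∎
    where open ≡-Reasoning

  ^-≢0 : ∀ {a} n → a ≢ 0# → a ^ n ≢ 0#
  ^-≢0 zero    a≢0 = 0≢1 ∘ sym
  ^-≢0 (suc n) a≢0 = *-≢0 a≢0 (^-≢0 n a≢0)

  product-≢0 : ∀ {n} (t : Fin n → Carrier) → (∀ i → t i ≢ 0#) → Multiplicative.sum t ≢ 0#
  product-≢0 {zero}  t t≢0 = 0≢1 ∘ sym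
  product-≢0 {suc n} t t≢0 = *-≢0 (t≢0 zero) (product-≢0 (t ∘ suc) (t≢0 ∘ suc))

  -- Multiplication by a nonzero `a` permutes F. To take a product over all of F, `unit` replaces
  -- the factor 0 by 1; the term at 0 then keeps one surplus factor `a`, which `correction` records
  -- and which becomes the right-hand side.
  x^card≡x : ∀ x → x ^ card ≡ x
  x^card≡x a with a ≟ 0#
  -- `index 0#` inhabits `Fin card`, which excludes the exponent zero.
  ... | yes refl = 0^n≡0 card (index 0#)
    where
    0^n≡0 : ∀ n → Fin n → 0# ^ n ≡ 0#
    0^n≡0 (suc n) _ = zeroˡ _
  ... | no a≢0 = *-cancelˡ (product-≢0 _ (λ i → unit-≢0 (element i))) (begin
      Π unit * a ^ card                         ≡⟨ cong (Π unit *_) (Multiplicative.sum-replicate card) ⟨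
      Π unit * Π (λ _ → a)                      ≡⟨ Multiplicative.total-∙ unit (λ _ → a) ⟨
      Π (λ x → unit x * a)                      ≡⟨ Multiplicative.total-cong unit-shift ⟩
      Π (λ x → unit (a * x) * correction x)     ≡⟨ Multiplicative.total-∙ (unit ∘ (a *_)) correction ⟩
      Π (λ x → unit (a * x)) * Π correction     ≡⟨ cong₂ _*_ (sym Π-shift) Π-correction ⟩
      Π unit * a                                ∎)
    where
    open ≡-Reasoning
    open Multiplicative using () renaming (total to Π)
    unit : Carrier → Carrier
    unit x with x ≟ 0#
    ... | yes _ = 1#
    ... | no _  = x
    unit-zero : unit 0# ≡ 1#
    unit-zero with 0# ≟ 0#
    ... | yes _  = refl
    ... | no 0≢0 = contradiction refl 0≢0
    unit-nonzero : ∀ {x} → x ≢ 0# → unit x ≡ x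
    unit-nonzero {x} x≢0 with x ≟ 0#
    ... | yes x≡0 = contradiction x≡0 x≢0
    ... | no _    = refl
    unit-≢0 : ∀ x → unit x ≢ 0#
    unit-≢0 x with x ≟ 0#
    ... | yes _  = 0≢1 ∘ sym
    ... | no x≢0 = x≢0
    correction : Carrier → Carrier
    correction x with x ≟ 0#
    ... | yes _ = a
    ... | no _  = 1#
    unit-shift : ∀ x → unit x * a ≡ unit (a * x) * correction x
    unit-shift x with x ≟ 0#
    ... | yes refl = cong (_* a) (sym (trans (cong unit (zeroʳ a)) unit-zero))
    ... | no x≢0   = begin
      x * a                ≡⟨ *-comm x a ⟩
      a * x                ≡⟨ unit-nonzero (*-≢0 a≢0 x≢0) ⟨
      unit (a * x)         ≡⟨ *-identityʳ _ ⟨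
      unit (a * x) * 1#    ∎
    Π-shift : Π unit ≡ Π (λ x → unit (a * x))
    Π-shift = Multiplicative.total-reindex unit (a *_) (inv a *_)
      (λ x → trans (sym (*-assoc _ _ _)) (trans (cong (_* x) (*-inv a≢0)) (*-identityˡ x)))
      (λ x → trans (sym (*-assoc _ _ _)) (trans (cong (_* x) (inv-* a≢0)) (*-identityˡ x)))
    correction-zero : correction 0# ≡ a
    correction-zero with 0# ≟ 0#
    ... | yes _  = refl
    ... | no 0≢0 = contradiction refl 0≢0
    correction-nonzero : ∀ x → x ≢ 0# → correction x ≡ 1#
    correction-nonzero x x≢0 with x ≟ 0#
    ... | yes x≡0 = contradiction x≡0 x≢0
    ... | no _    = refl
    Π-correction : Π correction ≡ a
    Π-correction = trans (Multiplicative.total-single correction 0# correction-nonzero) correction-zero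

  1^n≡1 : ∀ n → 1# ^ n ≡ 1#
  1^n≡1 zero    = refl
  1^n≡1 (suc n) = trans (*-identityˡ _) (1^n≡1 n)

  module Characteristic {p e : ℕ} (pr : Prime p) (card≡ : card ≡ p ℕ.^ e) where

    ^-·1 : ∀ m → (p ℕ.^ m) · 1# ≡ (p · 1#) ^ m
    ^-·1 zero    = +-identityʳ 1#
    ^-·1 (suc m) = trans (×1-homo-* p (p ℕ.^ m)) (cong ((p · 1#) *_) (^-·1 m))

    -- The power (p · 1)^e equals card · 1 = 0, and powers of nonzero elements of a field are
    -- nonzero.
    p·1≡0 : p · 1# ≡ 0#
    p·1≡0 with p · 1# ≟ 0#
    ... | yes eq = eq
    ... | no neq = contradiction (trans (sym (^-·1 e)) (trans (cong (_· 1#) (sym card≡)) card·1≡0)) (^-≢0 e neq)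

    p∣m⇒m·x≡0 : ∀ {m} → p ∣ m → ∀ x → m · x ≡ 0#
    p∣m⇒m·x≡0 (divides c refl) x = begin
      (c ℕ.* p) · x              ≡⟨ cong ((c ℕ.* p) ·_) (*-identityˡ x) ⟨
      (c ℕ.* p) · (1# * x)       ≡⟨ ×-assoc-* (c ℕ.* p) 1# x ⟨
      ((c ℕ.* p) · 1#) * x       ≡⟨ cong (_* x) (×1-homo-* c p) ⟩
      (c · 1#) * (p · 1#) * x    ≡⟨ cong (λ t → (c · 1#) * t * x) p·1≡0 ⟩
      (c · 1#) * 0# * x          ≡⟨ solve 2 (λ c x → c :* con (+ 0) :* x := con (+ 0)) refl (c · 1#) x ⟩
      0#                         ∎
      where open ≡-Reasoning

    frobenius-p : ∀ x y → (x + y) ^ p ≡ x ^ p + y ^ p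
    frobenius-p x y = expand p refl
      where
      open ≡-Reasoning
      open Binomial commutativeSemiring
      -- Generalising the exponent allows matching on `suc m`, which splits off the first term of
      -- the binomial sum; of the rest only the last term survives.
      expand : ∀ m → m ≡ p → (x + y) ^ m ≡ x ^ m + y ^ m
      expand zero refl = contradiction (ℕ.nonTrivial⇒n>1 0 ⦃ prime⇒nonTrivial pr ⦄) (λ ())
      expand (suc m) refl = begin
        (x + y) ^ suc m                                        ≡⟨ theorem (suc m) x y ⟩
        term zero + sum (λ i → term (suc i))                   ≡⟨ cong₂ _+_ first (Additive.sum-single (term ∘ suc) (fromℕ m) middle) ⟩
        y ^ suc m + term (suc (fromℕ m))                       ≡⟨ cong (λ t → y ^ suc m + t) last ⟩
        y ^ suc m + x ^ suc m                                  ≡⟨ +-comm _ _ ⟩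
        x ^ suc m + y ^ suc m                                  ∎
        where
        term : Fin (suc (suc m)) → Carrier
        term = binomialTerm x y (suc m)
        first : term zero ≡ y ^ suc m
        first = trans (+-identityʳ _) (*-identityˡ _)
        middle : ∀ j → j ≢ fromℕ m → term (suc j) ≡ 0#
        middle j j≢m = p∣m⇒m·x≡0 (prime∣C pr (ℕ.s≤s ℕ.z≤n) (ℕ.s≤s (ℕ.≤∧≢⇒< (ℕ.≤-pred (Fin.toℕ<n j))
          (λ eq → j≢m (Fin.toℕ-injective (trans eq (sym (Fin.toℕ-fromℕ m)))))))) _
        last : term (suc (fromℕ m)) ≡ x ^ suc m
        last = begin
          (suc m C suc (toℕ (fromℕ m))) · (x ^ suc (toℕ (fromℕ m)) * y ^ (m ∸ toℕ (fromℕ m)))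
            ≡⟨ cong (λ k → (suc m C suc k) · (x ^ suc k * y ^ (m ∸ k))) (Fin.toℕ-fromℕ m) ⟩
          (suc m C suc m) · (x ^ suc m * y ^ (m ∸ m))
            ≡⟨ cong₂ (λ b k → b · (x ^ suc m * y ^ k)) (nCn≡1 (suc m)) (ℕ.n∸n≡0 m) ⟩
          1 · (x ^ suc m * 1#)
            ≡⟨ +-identityʳ _ ⟩
          x ^ suc m * 1#
            ≡⟨ *-identityʳ _ ⟩
          x ^ suc m ∎

    frobenius : ∀ k x y → (x + y) ^ (p ℕ.^ k) ≡ x ^ (p ℕ.^ k) + y ^ (p ℕ.^ k)
    frobenius zero x y = trans (*-identityʳ _) (sym (cong₂ _+_ (*-identityʳ x) (*-identityʳ y)))
    frobenius (suc k) x y = begin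
      (x + y) ^ (p ℕ.* p ℕ.^ k)                          ≡⟨ ^-assocʳ (x + y) p (p ℕ.^ k) ⟨
      ((x + y) ^ p) ^ (p ℕ.^ k)                          ≡⟨ cong (_^ (p ℕ.^ k)) (frobenius-p x y) ⟩
      (x ^ p + y ^ p) ^ (p ℕ.^ k)                        ≡⟨ frobenius k _ _ ⟩
      (x ^ p) ^ (p ℕ.^ k) + (y ^ p) ^ (p ℕ.^ k)          ≡⟨ cong₂ _+_ (^-assocʳ x p _) (^-assocʳ y p _) ⟩
      x ^ (p ℕ.* p ℕ.^ k) + y ^ (p ℕ.* p ℕ.^ k)          ∎
      where open ≡-Reasoning

  frobenius-primePower : ∀ {q n} → IsPrimePower q → card ≡ q ℕ.^ n →
    ∀ t x y → (x + y) ^ (q ℕ.^ t) ≡ x ^ (q ℕ.^ t) + y ^ (q ℕ.^ t)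
  frobenius-primePower {n = n} (p , k , pr , _ , refl) card≡ t x y =
    subst (λ m → (x + y) ^ m ≡ x ^ m + y ^ m) (sym (ℕ.^-*-assoc p k t))
      (Characteristic.frobenius {e = k ℕ.* n} pr (trans card≡ (ℕ.^-*-assoc p k n)) (k ℕ.* t) x y)

-- Polynomial functions, their roots, and fixed fields of Frobenius maps.

module Polynomials (F : FiniteField) where
  open FieldPowers F

  -- Coefficients are listed from the constant term upwards; in `monic` the
  -- leading coefficient 1# is left implicit.
  poly monic : ∀ {d} → Vec Carrier d → Carrier → Carrier
  poly []       x = 0#
  poly (a ∷ as) x = a + x * poly as x
  monic []       x = 1#
  monic (a ∷ as) x = a + x * monic as x

  -- Synthetic division by x - r: the coefficients are the Horner values at `r` of the successive
  -- tails.
  quotient : ∀ {d} → Vec Carrier (suc d) → Carrier → Vec Carrier d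
  quotient (a ∷ [])     r = []
  quotient (a ∷ b ∷ as) r = monic (b ∷ as) r ∷ quotient (b ∷ as) r

  factor : ∀ {d} (as : Vec Carrier (suc d)) r x →
    monic as x - monic as r ≡ (x - r) * monic (quotient as r) x
  factor (a ∷ []) r x =
    solve 3 (λ a r x → (a :+ x :* con (+ 1)) :- (a :+ r :* con (+ 1)) := (x :- r) :* con (+ 1)) refl a r x
  factor (a ∷ b ∷ as) r x = begin
    (a + x * P) - (a + r * Pr)           ≡⟨ solve 5 (λ a r x P Pr → (a :+ x :* P) :- (a :+ r :* Pr)
                                              := x :* (P :- Pr) :+ (x :- r) :* Pr) refl a r x P Pr ⟩
    x * (P - Pr) + (x - r) * Pr          ≡⟨ cong (λ t → x * t + (x - r) * Pr) (factor (b ∷ as) r x) ⟩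
    x * ((x - r) * Q) + (x - r) * Pr     ≡⟨ solve 4 (λ r x Q Pr → x :* ((x :- r) :* Q) :+ (x :- r) :* Pr
                                              := (x :- r) :* (Pr :+ x :* Q)) refl r x Q Pr ⟩
    (x - r) * (Pr + x * Q)               ∎
    where
    open ≡-Reasoning
    P  = monic (b ∷ as) x
    Pr = monic (b ∷ as) r
    Q  = monic (quotient (b ∷ as) r) x

  -- Dividing by x - `s zero` lowers the degree by one and keeps the other roots, because that
  -- factor is nonzero at them.
  root-bound : ∀ {d} (as : Vec Carrier d) (s : Fin (suc d) → Carrier) →
    (∀ i j → s i ≡ s j → i ≡ j) → ¬ (∀ i → monic as (s i) ≡ 0#)
  root-bound [] s s-inj roots = 0≢1 (sym (roots zero))
  root-bound {suc d} as s s-inj roots =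
    root-bound (quotient as (s zero)) (s ∘ suc) (λ i j eq → Fin.suc-injective (s-inj _ _ eq)) quotient-roots
    where
    quotient-roots : ∀ i → monic (quotient as (s zero)) (s (suc i)) ≡ 0#
    quotient-roots i = *-cancelˡ difference≢0 (trans (sym (factor as (s zero) (s (suc i))))
      (trans (cong₂ _-_ (roots (suc i)) (roots zero)) (trans (-‿inverseʳ 0#) (sym (zeroʳ _)))))
      where
      difference≢0 : s (suc i) - s zero ≢ 0#
      difference≢0 eq with () ← s-inj _ _ (x-y≡0⇒x≡y _ _ eq)

  -- `IsPoly d` means degree strictly below `d`, so adding such a function to an `IsMonic d` one
  -- leaves the leading coefficient alone.
  IsMonic IsPoly : ℕ → (Carrier → Carrier) → Set
  IsMonic d g = Σ (Vec Carrier d) λ as → ∀ x → g x ≡ monic as x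
  IsPoly  d g = Σ (Vec Carrier d) λ as → ∀ x → g x ≡ poly as x

  -- Source of two existence statements: an element of nonzero trace, and an element of F_{q^t}
  -- outside F_q.
  monic-nonvanishing : ∀ {d g} → IsMonic d g → d ℕ.< card → ∃ λ x → g x ≢ 0#
  monic-nonvanishing {d} {g} (as , g≡) d<card with any? (λ x → Dec.¬? (g x ≟ 0#))
  ... | yes p = p
  ... | no ¬p = contradiction (λ i → trans (sym (g≡ (s i))) (Dec.decidable-stable (g (s i) ≟ 0#) (λ ≢0 → ¬p (s i , ≢0))))
                  (root-bound as s (λ i j eq → Fin.inject≤-injective d<card d<card i j (element-injective eq)))
    where
    s : Fin (suc d) → Carrier
    s i = element (inject≤ i d<card)

  isPoly-zero : ∀ d → IsPoly d (λ _ → 0#)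
  isPoly-zero d = replicate d 0# , eval d
    where
    eval : ∀ d x → 0# ≡ poly (replicate d 0#) x
    eval zero    x = refl
    eval (suc d) x = sym (trans (+-identityˡ _) (trans (cong (x *_) (sym (eval d x))) (zeroʳ x)))

  isPoly-+ : ∀ {d g h} → IsPoly d g → IsPoly d h → IsPoly d (λ x → g x + h x)
  isPoly-+ {g = g} {h} (as , g≡) (bs , h≡) = zipWith _+_ as bs , λ x → trans (cong₂ _+_ (g≡ x) (h≡ x)) (eval as bs x)
    where
    eval : ∀ {d} (as bs : Vec Carrier d) x → poly as x + poly bs x ≡ poly (zipWith _+_ as bs) x
    eval []       []       x = +-identityˡ 0#
    eval (a ∷ as) (b ∷ bs) x = trans
      (solve 5 (λ a b x p q → a :+ x :* p :+ (b :+ x :* q) := a :+ b :+ x :* (p :+ q)) refl a b x (poly as x) (poly bs x))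
      (cong (λ t → a + b + x * t) (eval as bs x))

  isPoly-neg : ∀ {d g} → IsPoly d g → IsPoly d (λ x → - g x)
  isPoly-neg (as , g≡) = map -_ as , λ x → trans (cong -_ (g≡ x)) (eval as x)
    where
    eval : ∀ {d} (as : Vec Carrier d) x → - poly as x ≡ poly (map -_ as) x
    eval []       x = solve 0 (:- con (+ 0) := con (+ 0)) refl
    eval (a ∷ as) x = trans (solve 3 (λ a x p → :- (a :+ x :* p) := :- a :+ x :* (:- p)) refl a x (poly as x))
      (cong (λ t → - a + x * t) (eval as x))

  isMonic-+ : ∀ {d g h} → IsMonic d g → IsPoly d h → IsMonic d (λ x → g x + h x)
  isMonic-+ (as , g≡) (bs , h≡) = zipWith _+_ as bs , λ x → trans (cong₂ _+_ (g≡ x) (h≡ x)) (eval as bs x)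
    where
    eval : ∀ {d} (as bs : Vec Carrier d) x → monic as x + poly bs x ≡ monic (zipWith _+_ as bs) x
    eval []       []       x = +-identityʳ 1#
    eval (a ∷ as) (b ∷ bs) x = trans
      (solve 5 (λ a b x p q → a :+ x :* p :+ (b :+ x :* q) := a :+ b :+ x :* (p :+ q)) refl a b x (monic as x) (poly bs x))
      (cong (λ t → a + b + x * t) (eval as bs x))

  isMonic-^ : ∀ d → IsMonic d (_^ d)
  isMonic-^ d = replicate d 0# , eval d
    where
    eval : ∀ d x → x ^ d ≡ monic (replicate d 0#) x
    eval zero    x = refl
    eval (suc d) x = trans (cong (x *_) (eval d x)) (sym (+-identityˡ _))

  isPoly-^ : ∀ {k d} → k ℕ.< d → IsPoly d (_^ k)
  isPoly-^ {zero} {suc d} (ℕ.s≤s k≤d) with zeros , zero≡ ← isPoly-zero d =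
    1# ∷ zeros , λ x → sym (trans (cong (λ t → 1# + x * t) (sym (zero≡ x))) (trans (cong (λ t → 1# + t) (zeroʳ x)) (+-identityʳ 1#)))
  isPoly-^ {suc k} {suc d} (ℕ.s≤s k<d) with as , eq ← isPoly-^ {k} {d} k<d =
    0# ∷ as , λ x → trans (cong (x *_) (eq x)) (sym (+-identityˡ _))

  -- Keeping the exponents as a function makes a Frobenius power a change of `E` only: every
  -- exponent is multiplied by Q.
  powerSum : (ℕ → ℕ) → ℕ → Carrier → Carrier
  powerSum E zero    x = 0#
  powerSum E (suc m) x = x ^ E 0 + powerSum (E ∘ suc) m x

  powerSum-last : ∀ E m x → powerSum E (suc m) x ≡ powerSum E m x + x ^ E m
  powerSum-last E zero    x = +-comm _ _
  powerSum-last E (suc m) x = trans (cong (λ t → x ^ E 0 + t) (powerSum-last (E ∘ suc) m x)) (sym (+-assoc _ _ _))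

  powerSum-cong : ∀ {E E′} → (∀ j → E j ≡ E′ j) → ∀ m x → powerSum E m x ≡ powerSum E′ m x
  powerSum-cong E≡ zero    x = refl
  powerSum-cong E≡ (suc m) x = cong₂ _+_ (cong (x ^_) (E≡ 0)) (powerSum-cong (E≡ ∘ suc) m x)

  isPoly-powerSum : ∀ {d} E m → (∀ j → j ℕ.< m → E j ℕ.< d) → IsPoly d (powerSum E m)
  isPoly-powerSum E zero    E< = isPoly-zero _
  isPoly-powerSum E (suc m) E< =
    isPoly-+ (isPoly-^ (E< 0 (ℕ.s≤s ℕ.z≤n))) (isPoly-powerSum (E ∘ suc) m (λ j j<m → E< (suc j) (ℕ.s≤s j<m)))

  isMonic-powerSum : ∀ E m → (∀ j → j ℕ.< m → E j ℕ.< E m) → IsMonic (E m) (powerSum E (suc m))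
  isMonic-powerSum E m E< with as , eq ← isMonic-+ (isMonic-^ (E m)) (isPoly-powerSum E m E<) =
    as , λ x → trans (powerSum-last E m x) (trans (+-comm _ _) (eq x))

  -- Used with Q = q and with Q = q^t, where `Fixed` describes F_q and F_{q^t}.
  module FrobeniusMap (Q : ℕ) (^Q-+ : ∀ x y → (x + y) ^ Q ≡ x ^ Q + y ^ Q) where

    0^Q : 0# ^ Q ≡ 0#
    0^Q = begin
      0# ^ Q                          ≡⟨ solve 1 (λ z → z := z :+ z :- z) refl (0# ^ Q) ⟩
      0# ^ Q + 0# ^ Q - 0# ^ Q        ≡⟨ cong (λ t → t - 0# ^ Q) (sym (^Q-+ 0# 0#)) ⟩
      (0# + 0#) ^ Q - 0# ^ Q          ≡⟨ cong (λ t → t ^ Q - 0# ^ Q) (+-identityˡ 0#) ⟩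
      0# ^ Q - 0# ^ Q                 ≡⟨ -‿inverseʳ _ ⟩
      0#                              ∎
      where open ≡-Reasoning

    powerSum-^Q : ∀ E m x → powerSum E m x ^ Q ≡ powerSum (λ j → E j ℕ.* Q) m x
    powerSum-^Q E zero    x = 0^Q
    powerSum-^Q E (suc m) x = trans (^Q-+ _ _) (cong₂ _+_ (^-assocʳ x (E 0) Q) (powerSum-^Q (E ∘ suc) m x))

    Fixed : Carrier → Set
    Fixed c = c ^ Q ≡ c

    fixed-1 : Fixed 1#
    fixed-1 = 1^n≡1 Q

    fixed-0 : Fixed 0#
    fixed-0 = 0^Q

    fixed-+ : ∀ {a b} → Fixed a → Fixed b → Fixed (a + b)
    fixed-+ {a} {b} fa fb = trans (^Q-+ a b) (cong₂ _+_ fa fb)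

    fixed-* : ∀ {a b} → Fixed a → Fixed b → Fixed (a * b)
    fixed-* {a} {b} fa fb = trans (^-distrib-* a b Q) (cong₂ _*_ fa fb)

    fixed-neg : ∀ {a} → Fixed a → Fixed (- a)
    fixed-neg {a} fa = begin
      (- a) ^ Q                     ≡⟨ solve 2 (λ a z → z := (a :+ z) :- a) refl a ((- a) ^ Q) ⟩
      (a + (- a) ^ Q) - a           ≡⟨ cong (λ t → (t + (- a) ^ Q) - a) (sym fa) ⟩
      (a ^ Q + (- a) ^ Q) - a       ≡⟨ cong (λ t → t - a) (sym (^Q-+ a (- a))) ⟩
      (a - a) ^ Q - a               ≡⟨ cong (λ t → t ^ Q - a) (-‿inverseʳ a) ⟩
      0# ^ Q - a                    ≡⟨ cong (λ t → t - a) 0^Q ⟩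
      0# - a                        ≡⟨ +-identityˡ _ ⟩
      - a                           ∎
      where open ≡-Reasoning

    fixed-inv : ∀ {a} → a ≢ 0# → Fixed a → Fixed (inv a)
    fixed-inv {a} a≢0 fa = *-cancelˡ a≢0 (begin
      a * inv a ^ Q          ≡⟨ cong (_* inv a ^ Q) fa ⟨
      a ^ Q * inv a ^ Q      ≡⟨ ^-distrib-* a (inv a) Q ⟨
      (a * inv a) ^ Q        ≡⟨ cong (_^ Q) (*-inv a≢0) ⟩
      1# ^ Q                 ≡⟨ 1^n≡1 Q ⟩
      1#                     ≡⟨ *-inv a≢0 ⟨
      a * inv a              ∎)
      where open ≡-Reasoning

    -- The trace onto the fixed field of x ↦ x ^ Q.
    fixed-powerSum : ∀ m → card ≡ Q ℕ.^ m → ∀ x → Fixed (powerSum (Q ℕ.^_) m x)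
    fixed-powerSum m card≡ x = begin
      S ^ Q                                          ≡⟨ powerSum-^Q (Q ℕ.^_) m x ⟩
      powerSum (λ j → Q ℕ.^ j ℕ.* Q) m x             ≡⟨ powerSum-cong (λ j → ℕ.*-comm (Q ℕ.^ j) Q) m x ⟩
      -- The exponents Q^j have moved up by one. Adding the missing `x` in front and splitting off
      -- the top power, whose exponent is `card`, returns to `S`.
      powerSum ((Q ℕ.^_) ∘ suc) m x                  ≡⟨ solve 2 (λ a s → s := a :+ s :- a) refl x _ ⟩
      x + powerSum ((Q ℕ.^_) ∘ suc) m x - x          ≡⟨ cong (λ t → t + powerSum ((Q ℕ.^_) ∘ suc) m x - x) (*-identityʳ x) ⟨
      powerSum (Q ℕ.^_) (suc m) x - x                ≡⟨ cong (λ t → t - x) (powerSum-last (Q ℕ.^_) m x) ⟩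
      S + x ^ (Q ℕ.^ m) - x                          ≡⟨ cong (λ k → S + x ^ k - x) card≡ ⟨
      S + x ^ card - x                               ≡⟨ cong (λ t → S + t - x) (x^card≡x x) ⟩
      S + x - x                                      ≡⟨ solve 2 (λ a s → s :+ a :- a := s) refl x S ⟩
      S                                              ∎
      where
      open ≡-Reasoning
      S = powerSum (Q ℕ.^_) m x

-- Duality between the image and the kernel of a linear map, for the form T(xy).

record Functional (F : FiniteField) : Set₁ where
  open FieldTheory F
  field
    Scalar     : Carrier → Set
    scalar?    : ∀ c → Dec (Scalar c)
    scalar-0   : Scalar 0#
    scalar-1   : Scalar 1#
    scalar-*   : ∀ {a b} → Scalar a → Scalar b → Scalar (a * b)
    scalar-neg : ∀ {a} → Scalar a → Scalar (- a)
    scalar-inv : ∀ {a} → a ≢ 0# → Scalar a → Scalar (inv a)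
    T          : Carrier → Carrier
    T-+        : ∀ x y → T (x + y) ≡ T x + T y
    T-*        : ∀ {c} → Scalar c → ∀ x → T (c * x) ≡ c * T x
    T-scalar   : ∀ x → Scalar (T x)
    unit       : Carrier
    T-unit     : T unit ≡ 1#

module LinearMaps {F : FiniteField} (τ : Functional F) where
  open FieldPowers F
  open Functional τ

  record Linear (f : Carrier → Carrier) : Set where
    field
      f-+ : ∀ x y → f (x + y) ≡ f x + f y
      f-* : ∀ {c} → Scalar c → ∀ x → f (c * x) ≡ c * f x

    f-0 : f 0# ≡ 0#
    f-0 = trans (cong f (sym (zeroˡ 0#))) (trans (f-* scalar-0 0#) (zeroˡ _))

    f-neg : ∀ x → f (- x) ≡ - f x
    f-neg x = begin
      f (- x)        ≡⟨ cong f (solve 1 (λ x → :- x := (:- con (+ 1)) :* x) refl x) ⟩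
      f (- 1# * x)   ≡⟨ f-* (scalar-neg scalar-1) x ⟩
      - 1# * f x     ≡⟨ solve 1 (λ x → (:- con (+ 1)) :* x := :- x) refl (f x) ⟩
      - f x          ∎
      where open ≡-Reasoning

    f-sub : ∀ x y → f (x - y) ≡ f x - f y
    f-sub x y = trans (f-+ x (- y)) (cong (λ t → f x + t) (f-neg y))

  T-linear : Linear T
  T-linear = record { f-+ = T-+ ; f-* = T-* }

  open Linear T-linear using () renaming (f-0 to T-0; f-neg to T-neg; f-sub to T-sub)

  -- For nonzero `u` the multiples of `u` fill F and so include `unit`, where `T` is 1.
  T-nondegenerate : ∀ u → (∀ x → T (u * x) ≡ 0#) → u ≡ 0#
  T-nondegenerate u u⊥ with u ≟ 0#
  ... | yes u≡0 = u≡0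
  ... | no u≢0  = contradiction (trans (sym (u⊥ (inv u * unit))) (trans (cong T cancel) T-unit)) 0≢1
    where
    cancel : u * (inv u * unit) ≡ unit
    cancel = trans (sym (*-assoc _ _ _)) (trans (cong (_* unit) (*-inv u≢0)) (*-identityˡ unit))

  module Image {f : Carrier → Carrier} (f-linear : Linear f) where
    open Linear f-linear

    Im : Carrier → Set
    Im y = ∃ λ x → f x ≡ y

    Im? : ∀ y → Dec (Im y)
    Im? y = any? (λ x → f x ≟ y)

    Im-0 : Im 0#
    Im-0 = 0# , f-0

    Im-+ : ∀ {a b} → Im a → Im b → Im (a + b)
    Im-+ (x , refl) (y , refl) = x + y , f-+ x y

    Im-neg : ∀ {a} → Im a → Im (- a)
    Im-neg (x , refl) = - x , f-neg x

    Im-sub : ∀ {a b} → Im a → Im b → Im (a - b)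
    Im-sub a b = Im-+ a (Im-neg b)

    Ker⊥ : Carrier → Set
    Ker⊥ w = ∀ k → f k ≡ 0# → T (w * k) ≡ 0#

    Ker⊥-+ : ∀ {a b} → Ker⊥ a → Ker⊥ b → Ker⊥ (a + b)
    Ker⊥-+ {a} {b} a⊥ b⊥ k fk≡0 = trans (cong T (distribʳ k a b)) (trans (T-+ _ _)
      (trans (cong₂ _+_ (a⊥ k fk≡0) (b⊥ k fk≡0)) (+-identityˡ 0#)))

    Ker⊥-neg : ∀ {a} → Ker⊥ a → Ker⊥ (- a)
    Ker⊥-neg {a} a⊥ k fk≡0 = trans (cong T (sym (-‿distribˡ-* a k))) (trans (T-neg _)
      (trans (cong -_ (a⊥ k fk≡0)) (solve 0 (:- con (+ 0) := con (+ 0)) refl)))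

    -- The lists hold preimages: an entry `b` stands for the vector `f b`. This keeps arguments of
    -- `f` at hand for pairing with elements of `Ker⊥`.
    Span : List Carrier → Carrier → Set
    Span []       y = y ≡ 0#
    Span (b ∷ bs) y = ∃ λ c → Scalar c × Span bs (y - c * f b)

    span? : ∀ bs y → Dec (Span bs y)
    span? []       y = y ≟ 0#
    span? (b ∷ bs) y = any? (λ c → scalar? c ×-dec span? bs (y - c * f b))

    Independent : List Carrier → Set
    Independent []       = ⊤
    Independent (b ∷ bs) = ¬ Span bs (f b) × Independent bs

    span-weaken : ∀ b bs {y} → Span bs y → Span (b ∷ bs) y
    span-weaken b bs {y} s = 0# , scalar-0 ,
      subst (Span bs) (solve 2 (λ y b → y := y :- con (+ 0) :* b) refl y (f b)) s

    -- Greedy choice: a vector is kept only if it is outside the span of those kept so far, which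
    -- finite search decides.
    spanning : ∀ m (s : Fin m → Carrier) → ∃ λ bs → Independent bs × (∀ i → Span bs (f (s i)))
    spanning zero    s = [] , tt , λ ()
    spanning (suc m) s with spanning m (s ∘ suc)
    ... | bs , ind , spans with span? bs (f (s zero))
    ...   | yes p = bs , ind , λ { zero → p ; (suc i) → spans i }
    ...   | no ¬p = s zero ∷ bs , (¬p , ind) , λ
      { zero    → 1# , scalar-1 , subst (Span bs) (solve 1 (λ y → con (+ 0) := y :- con (+ 1) :* y) refl (f (s zero))) (zero∈ bs)
      ; (suc i) → span-weaken (s zero) bs (spans i) }
      where
      zero∈ : ∀ bs → Span bs 0#
      zero∈ []       = refl
      zero∈ (b ∷ bs) = span-weaken b bs (zero∈ bs)

    basis : ∃ λ bs → Independent bs × (∀ x → Span bs (f x))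
    basis with bs , ind , spans ← spanning card element =
      bs , ind , λ x → subst (Span bs ∘ f) (element-index x) (spans (index x))

    -- For a basis bs, f ∘ coordinates bs embeds Ker⊥ into Im.
    coordinates : List Carrier → Carrier → Carrier
    coordinates []       w = 0#
    coordinates (b ∷ bs) w = T (w * b) * b + coordinates bs w

    coordinates-sub : ∀ bs v w → coordinates bs (v - w) ≡ coordinates bs v - coordinates bs w
    coordinates-sub []       v w = sym (-‿inverseʳ 0#)
    coordinates-sub (b ∷ bs) v w = begin
      T ((v - w) * b) * b + coordinates bs (v - w)
        ≡⟨ cong₂ (λ s t → s * b + t)
             (trans (cong T (solve 3 (λ v w b → (v :- w) :* b := v :* b :- w :* b) refl v w b)) (T-sub _ _))
             (coordinates-sub bs v w) ⟩
      (T (v * b) - T (w * b)) * b + (coordinates bs v - coordinates bs w)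
        ≡⟨ solve 5 (λ s t b c d → (s :- t) :* b :+ (c :- d) := (s :* b :+ c) :- (t :* b :+ d)) refl
             (T (v * b)) (T (w * b)) b (coordinates bs v) (coordinates bs w) ⟩
      (T (v * b) * b + coordinates bs v) - (T (w * b) * b + coordinates bs w) ∎
      where open ≡-Reasoning

    coordinates∈span : ∀ bs w {c} → Scalar c → Span bs (c * f (coordinates bs w))
    coordinates∈span []       w {c} c∈ = trans (cong (c *_) f-0) (zeroʳ c)
    coordinates∈span (b ∷ bs) w {c} c∈ = c * T (w * b) , scalar-* c∈ (T-scalar _) ,
      subst (Span bs) (sym eq) (coordinates∈span bs w c∈)
      where
      open ≡-Reasoning
      t = T (w * b)
      d = coordinates bs w
      eq : c * f (t * b + d) - c * t * f b ≡ c * f d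
      eq = begin
        c * f (t * b + d) - c * t * f b       ≡⟨ cong (λ s → c * s - c * t * f b) (trans (f-+ _ _) (cong (λ r → r + f d) (f-* (T-scalar _) b))) ⟩
        c * (t * f b + f d) - c * t * f b     ≡⟨ solve 4 (λ c t b d → c :* (t :* b :+ d) :- c :* t :* b := c :* d) refl c t (f b) (f d) ⟩
        c * f d                               ∎

    -- A nonzero leading coordinate could be divided out, placing `f b` in the span of the remaining
    -- vectors; independence therefore removes the coordinates one by one.
    coordinates-zero : ∀ bs → Independent bs → ∀ u → f (coordinates bs u) ≡ 0# → All (λ b → T (u * b) ≡ 0#) bs
    coordinates-zero []       ind         u eq = []
    coordinates-zero (b ∷ bs) (b∉ , ind) u eq with T (u * b) ≟ 0#
    ... | yes t≡0 = t≡0 ∷ coordinates-zero bs ind u (begin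
        f (coordinates bs u)                              ≡⟨ cong f (solve 2 (λ b d → d := con (+ 0) :* b :+ d) refl b _) ⟩
        f (0# * b + coordinates bs u)                     ≡⟨ cong (λ t → f (t * b + coordinates bs u)) t≡0 ⟨
        f (T (u * b) * b + coordinates bs u)              ≡⟨ eq ⟩
        0#                                                ∎)
      where open ≡-Reasoning
    ... | no t≢0 = contradiction (subst (Span bs) fb≡ (coordinates∈span bs u (scalar-neg (scalar-inv t≢0 (T-scalar _))))) b∉
      where
      open ≡-Reasoning
      t = T (u * b)
      d = coordinates bs u
      fb≡ : - inv t * f d ≡ f b
      fb≡ = begin
        - inv t * f d                              ≡⟨ solve 4 (λ i d t b → (:- i) :* d := t :* i :* b :- i :* (t :* b :+ d)) refl (inv t) (f d) t (f b) ⟩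
        t * inv t * f b - inv t * (t * f b + f d)  ≡⟨ cong₂ (λ p r → p * f b - inv t * r) (*-inv t≢0)
                                                        (trans (cong (λ r → r + f d) (sym (f-* (T-scalar _) b))) (trans (sym (f-+ _ _)) eq)) ⟩
        1# * f b - inv t * 0#                      ≡⟨ solve 2 (λ i b → con (+ 1) :* b :- i :* con (+ 0) := b) refl (inv t) (f b) ⟩
        f b                                        ∎

    -- Subtracting multiples of the `b` from `x` leaves an element of the kernel, and `u` is
    -- orthogonal both to the kernel and to each `b`.
    ⊥-span : ∀ bs u → Ker⊥ u → All (λ b → T (u * b) ≡ 0#) bs → ∀ x → Span bs (f x) → T (u * x) ≡ 0#
    ⊥-span []       u u⊥ []          x fx≡0        = u⊥ x fx≡0
    ⊥-span (b ∷ bs) u u⊥ (ub ∷ ubs) x (c , c∈ , s) = begin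
      T (u * x)                               ≡⟨ cong T (solve 4 (λ u x c b → u :* x := u :* (x :- c :* b) :+ c :* (u :* b)) refl u x c b) ⟩
      T (u * (x - c * b) + c * (u * b))       ≡⟨ T-+ _ _ ⟩
      T (u * (x - c * b)) + T (c * (u * b))   ≡⟨ cong₂ _+_ (⊥-span bs u u⊥ ubs (x - c * b) (subst (Span bs) f≡ s)) (T-* c∈ _) ⟩
      0# + c * T (u * b)                      ≡⟨ cong (λ t → 0# + c * t) ub ⟩
      0# + c * 0#                             ≡⟨ solve 1 (λ c → con (+ 0) :+ c :* con (+ 0) := con (+ 0)) refl c ⟩
      0#                                      ∎
      where
      open ≡-Reasoning
      f≡ : f x - c * f b ≡ f (x - c * b)
      f≡ = sym (trans (f-sub _ _) (cong (λ t → f x - t) (f-* c∈ b)))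

    -- An injection Im → Ker⊥ is onto, because Ker⊥ injects back into Im.
    Ker⊥-exhausted : (g : Carrier → Carrier) → (∀ y → Im y → Ker⊥ (g y)) →
      (∀ x y → g x ≡ g y → x ≡ y) → ∀ w → Ker⊥ w → ∃ λ y → Im y × g y ≡ w
    Ker⊥-exhausted g g⊥ g-inj w w⊥ = result (injective⇒surjective h h-inj (Φ w))
      where
      bs = proj₁ basis
      Φ : Carrier → Carrier
      Φ v = f (coordinates bs v)
      Φ-injective : ∀ v w → Ker⊥ v → Ker⊥ w → Φ v ≡ Φ w → v ≡ w
      Φ-injective v w v⊥ w⊥ eq = x-y≡0⇒x≡y v w (T-nondegenerate (v - w) (λ x →
        ⊥-span bs (v - w) (Ker⊥-+ v⊥ (Ker⊥-neg w⊥))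
          (coordinates-zero bs (proj₁ (proj₂ basis)) (v - w)
            (trans (cong f (coordinates-sub bs v w)) (trans (f-sub _ _) (trans (cong (λ t → t - Φ w) eq) (-‿inverseʳ _)))))
          x (proj₂ (proj₂ basis) x)))
      -- `Φ` is injective on `Ker⊥` with values in `Im`, so `Φ ∘ g` maps `Im` injectively into
      -- itself. The identity off `Im` extends it to an injective map of F, to which the pigeonhole
      -- principle applies.
      h : Carrier → Carrier
      h y with Im? y
      ... | yes _ = Φ (g y)
      ... | no _  = y
      h-inj : ∀ x y → h x ≡ h y → x ≡ y
      h-inj x y eq with Im? x | Im? y
      ... | yes x∈ | yes y∈ = g-inj x y (Φ-injective _ _ (g⊥ x x∈) (g⊥ y y∈) eq)
      ... | yes x∈ | no y∉  = contradiction (_ , eq) y∉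
      ... | no x∉  | yes y∈ = contradiction (_ , sym eq) x∉
      ... | no x∉  | no y∉  = eq
      result : (∃ λ y → h y ≡ Φ w) → ∃ λ y → Im y × g y ≡ w
      result (y , eq) with Im? y
      ... | yes y∈ = y , y∈ , Φ-injective _ _ (g⊥ y y∈) w⊥ eq
      ... | no y∉  = contradiction (_ , sym eq) y∉

half : ∀ m → ∃ λ h → m ≡ h ℕ.+ h ⊎ m ≡ suc (h ℕ.+ h)
half zero = 0 , inj₁ refl
half (suc m) with half m
... | h , inj₁ eq = h , inj₂ (cong suc eq)
... | h , inj₂ eq = suc h , inj₁ (cong suc (trans eq (sym (ℕ.+-suc h h))))

-- Linear maps with the slopes of the functional.

module Slopes {F : FiniteField} (τ : Functional F) where
  open FieldPowers F
  open Functional τ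
  open LinearMaps τ
  open Linear T-linear using () renaming (f-0 to T-0; f-sub to T-sub)

  -- The map f has the slopes f x / x of T, phrased through their reciprocals:
  -- the nonzero slopes of T are the inverses of the z with T z = 1.
  record SameSlopes (f : Carrier → Carrier) : Set where
    field
      slope⇒    : ∀ x → f x ≢ 0# → T (x * inv (f x)) ≡ 1#
      slope⇐    : ∀ z → T z ≡ 1# → ∃ λ x → f x ≢ 0# × x ≡ z * f x

  module Normalised {f : Carrier → Carrier} (f-linear : Linear f) (same : SameSlopes f) (f∋1 : ∃ λ x → f x ≡ 1#) where
    open Linear f-linear
    open SameSlopes same
    open Image f-linear

    inv-Im : ∀ {y} → Im y → Ker⊥ (inv y)
    inv-Im {y} (x , refl) k fk≡0 with f x ≟ 0#
    ... | yes fx≡0 = trans (cong (λ t → T (t * k)) (trans (cong inv fx≡0) inv-zero)) (trans (cong T (zeroˡ k)) T-0)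
    ... | no fx≢0  = begin
      T (i * k)                             ≡⟨ cong T (solve 3 (λ i k x → i :* k := (x :+ k) :* i :- x :* i) refl i k x) ⟩
      T ((x + k) * i - x * i)               ≡⟨ T-sub _ _ ⟩
      T ((x + k) * i) - T (x * i)           ≡⟨ cong₂ _-_ T[x+k] (slope⇒ x fx≢0) ⟩
      1# - 1#                               ≡⟨ -‿inverseʳ 1# ⟩
      0#                                    ∎
      where
      open ≡-Reasoning
      i = inv (f x)
      f[x+k] : f (x + k) ≡ f x
      f[x+k] = trans (f-+ x k) (trans (cong (λ t → f x + t) fk≡0) (+-identityʳ _))
      T[x+k] : T ((x + k) * i) ≡ 1#
      T[x+k] = trans (cong (λ t → T ((x + k) * inv t)) (sym f[x+k])) (slope⇒ (x + k) (λ eq → fx≢0 (trans (sym f[x+k]) eq)))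

    -- Inversion injects `Im` into `Ker⊥`, hence is onto by `Ker⊥-exhausted`.
    inv-Ker⊥ : ∀ {w} → Ker⊥ w → Im (inv w)
    inv-Ker⊥ {w} w⊥ with Ker⊥-exhausted inv (λ _ → inv-Im)
      (λ x y eq → trans (sym (inv-involutive x)) (trans (cong inv eq) (inv-involutive y))) w w⊥
    ... | y , y∈ , refl = subst Im (sym (inv-involutive y)) y∈

    -- Hua's identity a − (a⁻¹ + (b⁻¹ − a)⁻¹)⁻¹ = aba.
    hua : ∀ {a b} → Im a → Ker⊥ b → Im (a * b * a)
    hua {a} {b} a∈ b∈ with a ≟ 0# | b ≟ 0# | inv b - a ≟ 0#
    ... | yes refl | _ | _ = subst Im (solve 1 (λ b → con (+ 0) := con (+ 0) :* b :* con (+ 0)) refl b) Im-0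
    ... | _ | yes refl | _ = subst Im (solve 1 (λ a → con (+ 0) := a :* con (+ 0) :* a) refl a) Im-0
    -- Here Hua's formula is undefined, but a is the inverse of b and aba = a.
    ... | no a≢0 | no b≢0 | yes eq = subst Im (begin
        a              ≡⟨ *-identityˡ a ⟨
        1# * a         ≡⟨ cong (_* a) (inv-* b≢0) ⟨
        inv b * b * a  ≡⟨ cong (λ t → t * b * a) (x-y≡0⇒x≡y _ _ eq) ⟩
        a * b * a      ∎) a∈
      where open ≡-Reasoning
    ... | no a≢0 | no b≢0 | no d≢0 = subst Im (begin
        a - inv s                     ≡⟨ cong (λ t → a - t) (inv-unique s*t≡1) ⟩
        a - a * (1# - a * b)          ≡⟨ solve 2 (λ a b → a :- a :* (con (+ 1) :- a :* b) := a :* b :* a) refl a b ⟩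
        a * b * a                     ∎)
        -- Each inversion switches between `Im` and `Ker⊥`: `inv b` and `d` lie in `Im`, `inv a`,
        -- `inv d` and `s` in `Ker⊥`, and `inv s` in `Im` again, so every sum stays inside one
        -- group.
        (Im-sub a∈ (inv-Ker⊥ (Ker⊥-+ (inv-Im a∈) (inv-Im (Im-sub (inv-Ker⊥ b∈) a∈)))))
      where
      open ≡-Reasoning
      d = inv b - a
      s = inv a + inv d
      s*t≡1 : s * (a * (1# - a * b)) ≡ 1#
      s*t≡1 = begin
        (inv a + inv d) * (a * (1# - a * b))
          ≡⟨ cong (λ t → (inv a + inv d) * (a * (t - a * b))) (inv-* b≢0) ⟨
        (inv a + inv d) * (a * (inv b * b - a * b))
          ≡⟨ solve 5 (λ a b i j k → (i :+ k) :* (a :* (j :* b :- a :* b)) := i :* a :* (j :* b :- a :* b) :+ k :* (j :- a) :* a :* b)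
               refl a b (inv a) (inv b) (inv d) ⟩
        inv a * a * (inv b * b - a * b) + inv d * d * a * b
          ≡⟨ cong₂ (λ p r → p * (inv b * b - a * b) + r * a * b) (inv-* a≢0) (inv-* d≢0) ⟩
        1# * (inv b * b - a * b) + 1# * a * b
          ≡⟨ solve 3 (λ j a b → con (+ 1) :* (j :* b :- a :* b) :+ con (+ 1) :* a :* b := j :* b) refl (inv b) a b ⟩
        inv b * b
          ≡⟨ inv-* b≢0 ⟩
        1# ∎

    -- The case a = 1 of `hua`; this is where the normalisation of `f` is used.
    Ker⊥⇒Im : ∀ {b} → Ker⊥ b → Im b
    Ker⊥⇒Im {b} b∈ = subst Im (solve 1 (λ b → con (+ 1) :* b :* con (+ 1) := b) refl b) (hua f∋1 b∈)

    Im⇒Ker⊥ : ∀ {a} → Im a → Ker⊥ a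
    Im⇒Ker⊥ {a} a∈ = subst Ker⊥ (inv-involutive a) (inv-Im (Ker⊥⇒Im (inv-Im a∈)))

    Im-inv : ∀ {a} → Im a → Im (inv a)
    Im-inv a∈ = Ker⊥⇒Im (inv-Im a∈)

    Im-· : ∀ {a} n → Im a → Im (n · a)
    Im-· zero    a∈ = Im-0
    Im-· (suc n) a∈ = Im-+ a∈ (Im-· n a∈)

    Im-square : ∀ {a} → Im a → Im (a * a)
    Im-square {a} a∈ = subst Im (cong (_* a) (*-identityʳ a)) (hua a∈ (Im⇒Ker⊥ f∋1))

    -- Each use of `hua` puts one more factor `a` on both sides of the product, hence the even
    -- exponent.
    Im-^*  : ∀ {a b} h → Im a → Im b → Im (a ^ (h ℕ.+ h) * b)
    Im-^* zero a∈ b∈ = subst Im (sym (*-identityˡ _)) b∈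
    Im-^* {a} {b} (suc h) a∈ b∈ = subst Im
      (trans (solve 3 (λ a c b → a :* (c :* b) :* a := a :* (a :* c) :* b) refl a (a ^ (h ℕ.+ h)) b)
             (cong (λ m → a * a ^ m * b) (sym (ℕ.+-suc h h))))
      (hua a∈ (Im⇒Ker⊥ (Im-^* h a∈ b∈)))

    -- If |F| = 2h then ab = a^(2h) b; if |F| = 2h + 1 then ab = (h + 1) (2ab)
    -- with 2ab = (a + b)² − a² − b².
    Im-* : ∀ {a b} → Im a → Im b → Im (a * b)
    Im-* {a} {b} a∈ b∈ with half card
    ... | h , inj₁ even = subst Im (cong (_* b) (trans (cong (a ^_) (sym even)) (x^card≡x a))) (Im-^* h a∈ b∈)
    ... | h , inj₂ odd  = subst Im (begin
        suc h · (a * b + a * b)                   ≡⟨ ×-distrib (suc h) ⟩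
        suc h · (a * b) + suc h · (a * b)         ≡⟨ ×-homo-+ (a * b) (suc h) (suc h) ⟨
        (suc h ℕ.+ suc h) · (a * b)               ≡⟨ cong (λ m → suc m · (a * b)) (trans (ℕ.+-suc h h) (sym odd)) ⟩
        a * b + card · (a * b)                    ≡⟨ cong (λ t → a * b + t) (card·x≡0 (a * b)) ⟩
        a * b + 0#                                ≡⟨ +-identityʳ _ ⟩
        a * b                                     ∎)
        (Im-· (suc h) (subst Im
          (solve 2 (λ a b → (a :+ b) :* (a :+ b) :- a :* a :- b :* b := a :* b :+ a :* b) refl a b)
          (Im-sub (Im-sub (Im-square (Im-+ a∈ b∈)) (Im-square a∈)) (Im-square b∈))))
      where
      open ≡-Reasoning
      ×-distrib : ∀ m {x y} → m · (x + y) ≡ m · x + m · y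
      ×-distrib zero    = sym (+-identityˡ 0#)
      ×-distrib (suc m) {x} {y} = trans (cong (λ t → x + y + t) (×-distrib m))
        (solve 4 (λ x y s t → x :+ y :+ (s :+ t) := x :+ s :+ (y :+ t)) refl x y (m · x) (m · y))

    -- If f(ke) were nonzero, the slope condition would give T(k · e/f(ke)) = 1, although e/f(ke)
    -- lies in `Im`, which is orthogonal to the kernel.
    ker-* : ∀ {k e} → f k ≡ 0# → Im e → f (k * e) ≡ 0#
    ker-* {k} {e} fk≡0 e∈ with f (k * e) ≟ 0#
    ... | yes eq = eq
    ... | no neq = contradiction (trans (sym
        (trans (cong T (solve 3 (λ k e i → k :* e :* i := e :* i :* k) refl k e (inv (f (k * e)))))
               (Im⇒Ker⊥ (Im-* e∈ (Im-inv (k * e , refl))) k fk≡0)))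
        (slope⇒ (k * e) neq)) 0≢1

    -- Multiplication by `e` descends to F / ker f, so the equation f(ze) = e sees only the class of
    -- z.
    same-fibre : ∀ {z z′ e} → f z ≡ f z′ → Im e → f (z * e) ≡ f (z′ * e)
    same-fibre {z} {z′} {e} eq e∈ = x-y≡0⇒x≡y _ _ (begin
      f (z * e) - f (z′ * e)   ≡⟨ f-sub _ _ ⟨
      f (z * e - z′ * e)       ≡⟨ cong f (solve 3 (λ z z′ e → z :* e :- z′ :* e := (z :- z′) :* e) refl z z′ e) ⟩
      f ((z - z′) * e)         ≡⟨ ker-* (trans (f-sub z z′) (trans (cong (λ t → t - f z′) eq) (-‿inverseʳ _))) e∈ ⟩
      0#                       ∎)
      where open ≡-Reasoning

    *-inv-cancel : ∀ z {e} → e ≢ 0# → z * e * inv e ≡ z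
    *-inv-cancel z e≢0 = trans (*-assoc _ _ _) (trans (cong (z *_) (*-inv e≢0)) (*-identityʳ z))

    -- A class of {T = 1} modulo the kernel is encoded by the value `s` that `f` takes on it.
    Level : Carrier → Set
    Level s = ∃ λ z → T z ≡ 1# × f z ≡ s

    Level? : ∀ s → Dec (Level s)
    Level? s = any? (λ z → (T z ≟ 1#) ×-dec (f z ≟ s))

    Incident : Carrier → Carrier → Set
    Incident e s = e ≢ 0# × ∃ λ z → T z ≡ 1# × f z ≡ s × f (z * e) ≡ e

    Incident? : ∀ e s → Dec (Incident e s)
    Incident? e s = ¬? (e ≟ 0#) ×-dec any? (λ z → (T z ≟ 1#) ×-dec (f z ≟ s) ×-dec (f (z * e) ≟ e))

    -- The translation-stable set has count 0, and deleting `0#` from it leaves -1.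
    count-nonzero : {P : Carrier → Set} (P? : ∀ x → Dec (P x)) (a : Carrier) → a ≢ 0# → P 0# →
      (∀ x → P x → P (x + a)) → (∀ x → P (x + a) → P x) →
      total (λ x → indicator (¬? (x ≟ 0#) ×-dec P? x)) ≡ - 1#
    count-nonzero P? a a≢0 p0 up down = begin
      total χ*                     ≡⟨ solve 1 (λ s → s := con (+ 1) :+ s :- con (+ 1)) refl (total χ*) ⟩
      1# + total χ* - 1#           ≡⟨ cong (λ t → t + total χ* - 1#) (trans (total-single δ 0# δ-off) (indicator-true (0# ≟ 0#) refl)) ⟨
      total δ + total χ* - 1#      ≡⟨ cong (λ t → t - 1#) (total-+ δ χ*) ⟨
      total (λ x → δ x + χ* x) - 1#  ≡⟨ cong (λ t → t - 1#) (total-cong split) ⟩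
      total (λ x → indicator (P? x)) - 1#  ≡⟨ cong (λ t → t - 1#) (count-translation-invariant P? a a≢0 up down) ⟩
      0# - 1#                      ≡⟨ +-identityˡ _ ⟩
      - 1#                         ∎
      where
      open ≡-Reasoning
      δ χ* : Carrier → Carrier
      δ x = indicator (x ≟ 0#)
      χ* x = indicator (¬? (x ≟ 0#) ×-dec P? x)
      δ-off : ∀ x → x ≢ 0# → δ x ≡ 0#
      δ-off x = indicator-false (x ≟ 0#)
      split : ∀ x → δ x + χ* x ≡ indicator (P? x)
      split x with x ≟ 0# | P? x
      ... | yes refl | yes _  = +-identityʳ 1#
      ... | yes refl | no ¬p  = contradiction p0 ¬p
      ... | no _     | yes _  = +-identityˡ 1#
      ... | no _     | no _   = +-identityˡ 0#

    -- A nonzero e = f x meets the class of z = x/e, since f(ze) = f x. It meets no other: f(z′e) =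
    -- e = f(ze) can be divided by `e` with `same-fibre`.
    row : ∀ e → total (λ s → indicator (Incident? e s)) ≡ indicator (¬? (e ≟ 0#) ×-dec Im? e)
    row e with ¬? (e ≟ 0#) ×-dec Im? e
    ... | yes (e≢0 , (x , refl)) = trans
        (total-single _ (f z) (λ s s≢ → indicator-false (Incident? e s)
          (λ { (_ , z′ , _ , refl , fz′e) → s≢ (unique z′ fz′e) })))
        (indicator-true (Incident? e (f z)) (e≢0 , z , slope⇒ x e≢0 , refl , fze))
      where
      z = x * inv (f x)
      fze : f (z * f x) ≡ f x
      fze = cong f (trans (*-assoc _ _ _) (trans (cong (x *_) (inv-* e≢0)) (*-identityʳ x)))
      unique : ∀ z′ → f (z′ * e) ≡ e → f z′ ≡ f z
      unique z′ eq = trans (cong f (sym (*-inv-cancel z′ e≢0)))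
        (trans (same-fibre (trans eq (sym fze)) (Im-inv (x , refl))) (cong f (*-inv-cancel z e≢0)))
    ... | no ¬p = trans (total-cong (λ s → indicator-false (Incident? e s)
            (λ (e≢0 , z , _ , _ , eq) → ¬p (e≢0 , z * e , eq)))) Additive.total-ε

    -- For z in the class, `slope⇐` gives a nonzero solution e₀ of f(ze) = e. The solutions form a
    -- set containing 0 and stable under translation by e₀, so the nonzero ones count -1.
    column : ∀ s → total (λ e → indicator (Incident? e s)) ≡ indicator (Level? s) * - 1#
    column s with Level? s
    ... | no ¬p = trans (total-cong (λ e → indicator-false (Incident? e s)
            (λ (_ , z , Tz , fz , _) → ¬p (z , Tz , fz)))) (trans Additive.total-ε (sym (zeroˡ _)))
    ... | yes (z , Tz , refl) with slope⇐ z Tz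
    ...   | x , e₀≢0 , x≡ = trans (total-cong (λ e → indicator-cong (Incident? e s) (¬? (e ≟ 0#) ×-dec (f (z * e) ≟ e))
              (λ (e≢0 , z′ , _ , fz′ , eq) → e≢0 , trans (same-fibre (sym fz′) (z′ * e , eq)) eq)
              (λ (e≢0 , eq) → e≢0 , z , Tz , refl , eq)))
            (trans (count-nonzero (λ e → f (z * e) ≟ e) e₀ e₀≢0 (trans (cong f (zeroʳ z)) f-0)
                (λ e eq → trans (f[z[e+e₀]] e) (cong (λ t → t + e₀) eq))
                (λ e eq → cancel (trans (sym (f[z[e+e₀]] e)) eq)))
              (sym (*-identityˡ _)))
      where
      e₀ = f x
      f[z[e+e₀]] : ∀ e → f (z * (e + e₀)) ≡ f (z * e) + e₀
      f[z[e+e₀]] e = trans (cong f (distribˡ z e e₀)) (trans (f-+ _ _) (cong (λ t → f (z * e) + t) (cong f (sym x≡))))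
      cancel : ∀ {a b c} → a + c ≡ b + c → a ≡ b
      cancel {a} {b} {c} eq = trans (solve 2 (λ a c → a := a :+ c :- c) refl a c)
        (trans (cong (λ t → t - c) eq) (solve 2 (λ b c → b :+ c :- c := b) refl b c))

    -- Otherwise count the incident pairs (e , s) in F: by rows there are
    -- |Im| − 1 = −1 of them, by columns −|Level|, and Level is a union of
    -- cosets of the additive group generated by f y.
    kernel⊇ : ∀ y → T y ≡ 0# → f y ≡ 0#
    kernel⊇ y Ty≡0 with f y ≟ 0#
    ... | yes eq  = eq
    ... | no fy≢0 = contradiction (begin
        0#                                                        ≡⟨ zeroˡ _ ⟨
        0# * - 1#                                                 ≡⟨ cong (_* - 1#) (count-translation-invariant Level? (f y) fy≢0 up down) ⟨
        total (λ s → indicator (Level? s)) * - 1#                 ≡⟨ total-*ʳ (λ s → indicator (Level? s)) (- 1#) ⟨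
        total (λ s → indicator (Level? s) * - 1#)                 ≡⟨ total-cong column ⟨
        total (λ s → total (λ e → indicator (Incident? e s)))     ≡⟨ total-comm (λ e s → indicator (Incident? e s)) ⟨
        total (λ e → total (λ s → indicator (Incident? e s)))     ≡⟨ total-cong row ⟩
        total (λ e → indicator (¬? (e ≟ 0#) ×-dec Im? e))         ≡⟨ count-nonzero Im? 1# (0≢1 ∘ sym) Im-0 (λ e e∈ → Im-+ e∈ f∋1)
                                                                       (λ e e∈ → subst Im (solve 1 (λ e → e :+ con (+ 1) :- con (+ 1) := e) refl e) (Im-sub e∈ f∋1)) ⟩
        - 1#                                                      ∎) (λ eq → 0≢1 (begin
        0#                ≡⟨ -‿inverseʳ 1# ⟨
        1# - 1#           ≡⟨ cong (λ t → 1# + t) eq ⟨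
        1# + 0#           ≡⟨ +-identityʳ 1# ⟩
        1#                ∎))
      where
      open ≡-Reasoning
      up : ∀ s → Level s → Level (s + f y)
      up s (z , Tz , refl) = z + y , trans (T-+ z y) (trans (cong₂ _+_ Tz Ty≡0) (+-identityʳ 1#)) , f-+ z y
      down : ∀ s → Level (s + f y) → Level s
      down s (z , Tz , fz) = z - y , trans (T-sub z y) (trans (cong₂ _-_ Tz Ty≡0) (solve 0 (con (+ 1) :- con (+ 0) := con (+ 1)) refl)) ,
        trans (f-sub z y) (trans (cong (λ t → t - f y) fz) (solve 2 (λ s t → s :+ t :- t := s) refl s (f y)))

    -- As ker T ⊆ ker f, `f` is `T` times s = f(unit). The normalisation makes 1/s a value c of `T`,
    -- hence a scalar, and the slope at `unit` then reads T(c · unit) = 1, that is c = 1.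
    f≡T : ∀ x → f x ≡ T x
    f≡T x = begin
      f x             ≡⟨ f≡ x ⟩
      T x * s         ≡⟨ cong (T x *_) s≡1 ⟩
      T x * 1#        ≡⟨ *-identityʳ _ ⟩
      T x             ∎
      where
      open ≡-Reasoning
      s = f unit
      f≡ : ∀ x → f x ≡ T x * s
      f≡ x = x-y≡0⇒x≡y _ _ (begin
        f x - T x * s           ≡⟨ cong (λ t → f x - t) (f-* (T-scalar x) unit) ⟨
        f x - f (T x * unit)    ≡⟨ f-sub _ _ ⟨
        f (x - T x * unit)      ≡⟨ kernel⊇ _ (trans (T-sub _ _) (trans
                                     (cong (λ t → T x - t) (trans (T-* (T-scalar x) unit) (trans (cong (T x *_) T-unit) (*-identityʳ _))))
                                     (-‿inverseʳ _))) ⟩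
        0#                      ∎)
      x₁ = proj₁ f∋1
      c = T x₁
      s*c≡1 : s * c ≡ 1#
      s*c≡1 = trans (*-comm s c) (trans (sym (f≡ x₁)) (proj₂ f∋1))
      c≡1 : c ≡ 1#
      c≡1 = begin
        c                       ≡⟨ *-identityʳ c ⟨
        c * 1#                  ≡⟨ cong (c *_) T-unit ⟨
        c * T unit              ≡⟨ T-* (T-scalar x₁) unit ⟨
        T (c * unit)            ≡⟨ cong T (*-comm c unit) ⟩
        T (unit * c)            ≡⟨ cong (λ t → T (unit * t)) (inv-unique s*c≡1) ⟨
        T (unit * inv s)        ≡⟨ slope⇒ unit (*≡1⇒≢0 s*c≡1) ⟩
        1#                      ∎
      s≡1 : s ≡ 1#
      s≡1 = trans (sym (*-identityʳ s)) (trans (cong (s *_) (sym c≡1)) s*c≡1)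

  -- With β a nonzero value of `f`, the map g(x) = f(βx)/β has the slopes of `f` and takes the value
  -- 1, so g = T; substituting x/β for x gives l = 1/β.
  sameSlopes⇒scaled : ∀ {f} → Linear f → SameSlopes f → ∃ λ l → l ≢ 0# × (∀ x → l * f x ≡ T (l * x))
  sameSlopes⇒scaled {f} f-linear same with SameSlopes.slope⇐ same unit T-unit
  ... | x₀ , β≢0 , _ = inv β , inv-≢0 β≢0 , λ x → begin
      inv β * f x                    ≡⟨ cong (λ t → inv β * f t) (β-cancel x) ⟨
      inv β * f (β * (inv β * x))    ≡⟨ Normalised.f≡T g-linear g-same g∋1 (inv β * x) ⟩
      T (inv β * x)                  ∎
    where
    open ≡-Reasoning
    open Linear f-linear
    open SameSlopes same
    β = f x₀
    β-cancel : ∀ x → β * (inv β * x) ≡ x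
    β-cancel x = trans (sym (*-assoc _ _ _)) (trans (cong (_* x) (*-inv β≢0)) (*-identityˡ x))
    g : Carrier → Carrier
    g x = inv β * f (β * x)
    g-linear : Linear g
    g-linear = record
      { f-+ = λ x y → trans (cong (λ t → inv β * t) (trans (cong f (distribˡ β x y)) (f-+ _ _))) (distribˡ _ _ _)
      ; f-* = λ {c} c∈ x → trans (cong (λ t → inv β * t) (trans
          (cong f (solve 3 (λ β c x → β :* (c :* x) := c :* (β :* x)) refl β c x)) (f-* c∈ _)))
          (solve 3 (λ i c y → i :* (c :* y) := c :* (i :* y)) refl (inv β) c (f (β * x)))
      }
    f≡β*g : ∀ x → f (β * x) ≡ β * g x
    f≡β*g x = sym (β-cancel _)
    g∋1 : ∃ λ x → g x ≡ 1#
    g∋1 = inv β * x₀ , trans (cong (λ t → inv β * f t) (β-cancel x₀)) (inv-* β≢0)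
    g-slope⇒ : ∀ x → g x ≢ 0# → T (x * inv (g x)) ≡ 1#
    g-slope⇒ x gx≢0 = trans (cong T (sym eq)) (slope⇒ (β * x) f≢0)
      where
      f≢0 : f (β * x) ≢ 0#
      f≢0 e = gx≢0 (trans (cong (inv β *_) e) (zeroʳ _))
      eq : β * x * inv (f (β * x)) ≡ x * inv (g x)
      eq = *-cancelˡ gx≢0 (begin
        g x * (β * x * inv (f (β * x)))      ≡⟨ solve 4 (λ g β x i → g :* (β :* x :* i) := β :* g :* i :* x) refl (g x) β x _ ⟩
        β * g x * inv (f (β * x)) * x        ≡⟨ cong (λ t → t * inv (f (β * x)) * x) (f≡β*g x) ⟨
        f (β * x) * inv (f (β * x)) * x      ≡⟨ cong (_* x) (*-inv f≢0) ⟩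
        1# * x                               ≡⟨ cong (_* x) (*-inv gx≢0) ⟨
        g x * inv (g x) * x                  ≡⟨ solve 3 (λ g i x → g :* i :* x := g :* (x :* i)) refl (g x) (inv (g x)) x ⟩
        g x * (x * inv (g x))                ∎)
    g-slope⇐ : ∀ z → T z ≡ 1# → ∃ λ x → g x ≢ 0# × x ≡ z * g x
    g-slope⇐ z Tz with slope⇐ z Tz
    ... | x , fx≢0 , x≡ = inv β * x
        , (λ e → fx≢0 (trans (sym (cong f (β-cancel x))) (trans (f≡β*g _) (trans (cong (β *_) e) (zeroʳ β)))))
        , (begin
          inv β * x                           ≡⟨ cong (inv β *_) x≡ ⟩
          inv β * (z * f x)                   ≡⟨ solve 3 (λ i z y → i :* (z :* y) := z :* (i :* y)) refl (inv β) z (f x) ⟩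
          z * (inv β * f x)                   ≡⟨ cong (λ t → z * (inv β * f t)) (β-cancel x) ⟨
          z * g (inv β * x)                   ∎)
    g-same : SameSlopes g
    g-same = record { slope⇒ = g-slope⇒ ; slope⇐ = g-slope⇐ }

primePower>1 : ∀ {q} → IsPrimePower q → 1 ℕ.< q
primePower>1 (p , k , pr , 1≤k , refl) = ℕ.<-≤-trans (ℕ.nonTrivial⇒n>1 p ⦃ prime⇒nonTrivial pr ⦄)
  (subst (ℕ._≤ p ℕ.^ k) (ℕ.*-identityʳ p)
    (ℕ.^-monoʳ-≤ p ⦃ ℕ.nonTrivial⇒nonZero p ⦃ prime⇒nonTrivial pr ⦄ ⦄ 1≤k))

-- The trace, and the subfields F_{q^t} of F.

module TraceForm (F : FiniteField) (q n : ℕ) (q-primePower : IsPrimePower q) (2≤n : 2 ≤ n)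
                 (card≡ : FiniteField.card F ≡ q ℕ.^ n) where
  open FieldPowers F
  open Polynomials F

  pow≡^ : ∀ x k → pow F q n x k ≡ x ^ k
  pow≡^ x zero    = refl
  pow≡^ x (suc k) = cong (x *_) (pow≡^ x k)

  1<q : 1 ℕ.< q
  1<q = primePower>1 q-primePower

  ^-+ : ∀ t x y → (x + y) ^ (q ℕ.^ t) ≡ x ^ (q ℕ.^ t) + y ^ (q ℕ.^ t)
  ^-+ = frobenius-primePower {n = n} q-primePower card≡

  ^q-+ : ∀ x y → (x + y) ^ q ≡ x ^ q + y ^ q
  ^q-+ x y = subst (λ m → (x + y) ^ m ≡ x ^ m + y ^ m) (ℕ.*-identityʳ q) (^-+ 1 x y)

  module Fq = FrobeniusMap q ^q-+
  module Fqᵗ t = FrobeniusMap (q ℕ.^ t) (^-+ t)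

  fixed⇒inSubfield : ∀ t {c} → Fqᵗ.Fixed t c → InSubfield F q n t c
  fixed⇒inSubfield t {c} eq = trans (pow≡^ c (q ℕ.^ t)) eq

  inSubfield⇒fixed : ∀ {c} → InSubfield F q n 1 c → Fq.Fixed c
  inSubfield⇒fixed {c} eq = trans (cong (c ^_) (sym (ℕ.*-identityʳ q))) (trans (sym (pow≡^ c (q ℕ.^ 1))) eq)

  Fq⊆Fqᵗ : ∀ t {c} → Fq.Fixed c → Fqᵗ.Fixed t c
  Fq⊆Fqᵗ zero    {c} eq = *-identityʳ c
  Fq⊆Fqᵗ (suc t) {c} eq = trans (sym (^-assocʳ c q (q ℕ.^ t))) (trans (cong (_^ (q ℕ.^ t)) eq) (Fq⊆Fqᵗ t eq))

  fixed⇒inSubfield₁ : ∀ {c} → Fq.Fixed c → InSubfield F q n 1 c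
  fixed⇒inSubfield₁ eq = fixed⇒inSubfield 1 (Fq⊆Fqᵗ 1 eq)

  Σ-cong : ∀ m {g h : Fin m → Carrier} → (∀ i → g i ≡ h i) → sumF F q n m g ≡ sumF F q n m h
  Σ-cong zero    eq = refl
  Σ-cong (suc m) eq = cong₂ _+_ (eq zero) (Σ-cong m (eq ∘ suc))

  Σ-+ : ∀ m (g h : Fin m → Carrier) → sumF F q n m (λ i → g i + h i) ≡ sumF F q n m g + sumF F q n m h
  Σ-+ zero    g h = sym (+-identityˡ 0#)
  Σ-+ (suc m) g h = trans (cong (λ t → g zero + h zero + t) (Σ-+ m (g ∘ suc) (h ∘ suc)))
    (solve 4 (λ a b s t → a :+ b :+ (s :+ t) := a :+ s :+ (b :+ t)) refl (g zero) (h zero) _ _)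

  Σ-* : ∀ m c (g : Fin m → Carrier) → sumF F q n m (λ i → c * g i) ≡ c * sumF F q n m g
  Σ-* zero    c g = sym (zeroʳ c)
  Σ-* (suc m) c g = trans (cong (λ t → c * g zero + t) (Σ-* m c (g ∘ suc))) (sym (distribˡ c _ _))

  pow-+ : ∀ t x y → pow F q n (x + y) (q ℕ.^ t) ≡ pow F q n x (q ℕ.^ t) + pow F q n y (q ℕ.^ t)
  pow-+ t x y = trans (pow≡^ (x + y) (q ℕ.^ t)) (trans (^-+ t x y) (sym (cong₂ _+_ (pow≡^ x (q ℕ.^ t)) (pow≡^ y (q ℕ.^ t)))))

  pow-* : ∀ t {c} → Fq.Fixed c → ∀ x → pow F q n (c * x) (q ℕ.^ t) ≡ c * pow F q n x (q ℕ.^ t)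
  pow-* t {c} c∈ x = trans (pow≡^ (c * x) (q ℕ.^ t))
    (trans (^-distrib-* c x (q ℕ.^ t)) (cong₂ _*_ (Fq⊆Fqᵗ t c∈) (sym (pow≡^ x (q ℕ.^ t)))))

  qPoly-+ : ∀ a x y → evalQPoly F q n a (x + y) ≡ evalQPoly F q n a x + evalQPoly F q n a y
  qPoly-+ a x y = trans (Σ-cong n (λ i → trans (cong (a i *_) (pow-+ (toℕ i) x y)) (distribˡ _ _ _))) (Σ-+ n _ _)

  qPoly-* : ∀ a {c} → Fq.Fixed c → ∀ x → evalQPoly F q n a (c * x) ≡ c * evalQPoly F q n a x
  qPoly-* a {c} c∈ x = trans (Σ-cong n (λ i → trans (cong (a i *_) (pow-* (toℕ i) c∈ x))
    (solve 3 (λ a c y → a :* (c :* y) := c :* (a :* y)) refl (a i) c _))) (Σ-* n c _)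

  tr : Carrier → Carrier
  tr = Tr F q n

  tr-+ : ∀ x y → tr (x + y) ≡ tr x + tr y
  tr-+ x y = trans (Σ-cong n (λ i → pow-+ (toℕ i) x y)) (Σ-+ n _ _)

  tr-* : ∀ {c} → Fq.Fixed c → ∀ x → tr (c * x) ≡ c * tr x
  tr-* {c} c∈ x = trans (Σ-cong n (λ i → pow-* (toℕ i) c∈ x)) (Σ-* n c _)

  tr≡powerSum : ∀ x → tr x ≡ powerSum (q ℕ.^_) n x
  tr≡powerSum x = go n (q ℕ.^_)
    where
    go : ∀ m E → sumF F q n m (λ i → pow F q n x (E (toℕ i))) ≡ powerSum E m x
    go zero    E = refl
    go (suc m) E = cong₂ _+_ (pow≡^ x (E 0)) (go m (E ∘ suc))

  tr-fixed : ∀ x → Fq.Fixed (tr x)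
  tr-fixed x = subst Fq.Fixed (sym (tr≡powerSum x)) (Fq.fixed-powerSum n card≡ x)

  abstract
    -- The trace is monic of degree q^(n-1), below |F|. With n = 2 + o the top exponent index n - 1
    -- is `suc o`.
    tr≢0 : ∃ λ x → tr x ≢ 0#
    tr≢0 with ℕ.m≤n⇒∃[o]m+o≡n 2≤n
    ... | o , n≡ with monic-nonvanishing
        (isMonic-powerSum (q ℕ.^_) (suc o) (λ _ → ℕ.^-monoʳ-< q 1<q))
        (subst (q ℕ.^ suc o ℕ.<_) (sym card≡) (ℕ.^-monoʳ-< q 1<q (subst (suc o ℕ.<_) n≡ (ℕ.n<1+n (suc o)))))
    ...   | x , ≢0 = x , λ eq → ≢0 (trans (cong (λ k → powerSum (q ℕ.^_) k x) n≡) (trans (sym (tr≡powerSum x)) eq))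

  traceFunctional : Functional F
  traceFunctional = record
    { Scalar     = Fq.Fixed
    ; scalar?    = λ c → c ^ q ≟ c
    ; scalar-0   = Fq.fixed-0
    ; scalar-1   = Fq.fixed-1
    ; scalar-*   = Fq.fixed-*
    ; scalar-neg = Fq.fixed-neg
    ; scalar-inv = Fq.fixed-inv
    ; T          = tr
    ; T-+        = tr-+
    ; T-*        = tr-*
    ; T-scalar   = tr-fixed
    ; unit       = inv (tr x) * x
    ; T-unit     = trans (tr-* (Fq.fixed-inv trx≢0 (tr-fixed x)) x) (inv-* trx≢0)
    }
    where
    x = proj₁ tr≢0
    trx≢0 = proj₂ tr≢0

  card≡Qᵐ : ∀ t m → n ≡ m ℕ.* t → card ≡ (q ℕ.^ t) ℕ.^ m
  card≡Qᵐ t m n≡ = trans card≡ (trans (cong (q ℕ.^_) (trans n≡ (ℕ.*-comm m t))) (sym (ℕ.^-*-assoc q t m)))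

  -- The relative trace S onto F_{q^t} satisfies S(x)^q ≠ S(x) for some x,
  -- because S^q − S is monic of degree q^(n−t+1) < q^n.
  proper-extension : ∀ t → 1 ℕ.< t → t ∣ n → ∃ λ ω → Fqᵗ.Fixed t ω × ¬ Fq.Fixed ω
  proper-extension t 1<t (divides zero n≡0) = contradiction (subst (2 ≤_) n≡0 2≤n) (λ ())
  proper-extension t 1<t (divides (suc m) n≡) with monic-nonvanishing difference-monic (subst (E′ m ℕ.<_) (sym (card≡Qᵐ t (suc m) n≡)) degree<)
    where
    instance
      q≢0 : ℕ.NonZero q
      q≢0 = ℕ.>-nonZero (ℕ.<-trans (ℕ.s≤s ℕ.z≤n) 1<q)
    Q = q ℕ.^ t
    instance
      Q≢0 : ℕ.NonZero Q
      Q≢0 = ℕ.m^n≢0 q t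
      Qᵐ≢0 : ℕ.NonZero (Q ℕ.^ m)
      Qᵐ≢0 = ℕ.m^n≢0 Q m
    E′ : ℕ → ℕ
    E′ j = Q ℕ.^ j ℕ.* q
    q<Q : q ℕ.< Q
    q<Q = subst (ℕ._< Q) (ℕ.*-identityʳ q) (ℕ.^-monoʳ-< q 1<q 1<t)
    degree< : E′ m ℕ.< Q ℕ.^ suc m
    degree< = subst (E′ m ℕ.<_) (ℕ.*-comm (Q ℕ.^ m) Q) (ℕ.*-monoʳ-< (Q ℕ.^ m) q<Q)
    -- `E′` lists the exponents of S^q; those of S are at most Q^m, below the leading exponent Q^m ·
    -- q.
    difference-monic : IsMonic (E′ m) (λ x → powerSum E′ (suc m) x - powerSum (Q ℕ.^_) (suc m) x)
    difference-monic = isMonic-+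
      (isMonic-powerSum E′ m (λ j j<m → ℕ.*-monoˡ-< q (ℕ.^-monoʳ-< Q (ℕ.<-trans 1<q q<Q) j<m)))
      (isPoly-neg (isPoly-powerSum (Q ℕ.^_) (suc m) (λ j j<1+m →
        ℕ.≤-<-trans (ℕ.^-monoʳ-≤ Q (ℕ.≤-pred j<1+m)) (ℕ.m<m*n (Q ℕ.^ m) q 1<q))))
  ... | x , ≢0 = S , Fqᵗ.fixed-powerSum t (suc m) (card≡Qᵐ t (suc m) n≡) x ,
      λ eq → ≢0 (trans (cong (λ s → s - S) (trans (sym (Fq.powerSum-^Q (Q ℕ.^_) (suc m) x)) eq)) (-‿inverseʳ S))
    where
    Q = q ℕ.^ t
    S = powerSum (Q ℕ.^_) (suc m) x

-- The linear set L_V: slopes, field of linearity and simplicity.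

module LinearSets (F : FiniteField) (q n : ℕ) (q-primePower : IsPrimePower q) (2≤n : 2 ≤ n)
                  (card≡ : FiniteField.card F ≡ q ℕ.^ n) where
  open FieldPowers F
  open TraceForm F q n q-primePower 2≤n card≡
  open Functional traceFunctional using (unit; T-unit)
  open LinearMaps traceFunctional
  open Slopes traceFunctional
  open Linear T-linear using () renaming (f-0 to tr-0)

  V : SubsetW F q n
  V = graph F q n tr

  qPoly-linear : ∀ a → Linear (evalQPoly F q n a)
  qPoly-linear a = record { f-+ = qPoly-+ a ; f-* = qPoly-* a }

  -- A point other than ⟨(1,0)⟩ is ⟨(z,1)⟩ for a unique z. It lies on L_V exactly when tr z = 1,
  -- because y / tr y has trace 1 whenever tr y is nonzero.
  linSetEq⇒sameSlopes : ∀ {f} → LinSetEq F q n (graph F q n f) V → SameSlopes f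
  linSetEq⇒sameSlopes {f} (sub , sup) = record { slope⇒ = to ; slope⇐ = from }
    where
    open ≡-Reasoning
    to : ∀ x → f x ≢ 0# → tr (x * inv (f x)) ≡ 1#
    to x fx≢0 with sub (x , f x) (x , refl) (fx≢0 ∘ cong proj₂)
    ... | _ , (y , refl) , _ , μ , eq = begin
        tr (x * inv (f x))       ≡⟨ cong tr ratio ⟩
        tr (inv (tr y) * y)      ≡⟨ tr-* (Fq.fixed-inv try≢0 (tr-fixed y)) y ⟩
        inv (tr y) * tr y        ≡⟨ inv-* try≢0 ⟩
        1#                       ∎
      where
      x≡ = cong proj₁ eq
      fx≡ = cong proj₂ eq
      try≢0 : tr y ≢ 0#
      try≢0 try≡0 = fx≢0 (trans fx≡ (trans (cong (μ *_) try≡0) (zeroʳ μ)))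
      ratio : x * inv (f x) ≡ inv (tr y) * y
      ratio = *-cancelˡ fx≢0 (begin
        f x * (x * inv (f x))          ≡⟨ solve 3 (λ a x i → a :* (x :* i) := a :* i :* x) refl (f x) x (inv (f x)) ⟩
        f x * inv (f x) * x            ≡⟨ cong (_* x) (*-inv fx≢0) ⟩
        1# * x                         ≡⟨ cong₂ _*_ (sym (*-inv try≢0)) x≡ ⟩
        tr y * inv (tr y) * (μ * y)    ≡⟨ solve 4 (λ t i μ y → t :* i :* (μ :* y) := μ :* t :* (i :* y)) refl (tr y) (inv (tr y)) μ y ⟩
        μ * tr y * (inv (tr y) * y)    ≡⟨ cong (_* (inv (tr y) * y)) fx≡ ⟨
        f x * (inv (tr y) * y)         ∎)
    from : ∀ z → tr z ≡ 1# → ∃ λ x → f x ≢ 0# × x ≡ z * f x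
    from z trz≡1 with sup (z , tr z) (z , refl) (λ eq → 0≢1 (trans (sym (cong proj₂ eq)) trz≡1))
    ... | _ , (x , refl) , _ , μ , eq = x , *≡1⇒≢0 (trans (*-comm _ _) μfx≡1) , (begin
        x                  ≡⟨ *-identityˡ x ⟨
        1# * x             ≡⟨ cong (_* x) μfx≡1 ⟨
        μ * f x * x        ≡⟨ solve 3 (λ μ a x → μ :* a :* x := μ :* x :* a) refl μ (f x) x ⟩
        μ * x * f x        ≡⟨ cong (_* f x) (cong proj₁ eq) ⟨
        z * f x            ∎)
      where
      μfx≡1 : μ * f x ≡ 1#
      μfx≡1 = trans (sym (cong proj₂ eq)) trz≡1

  -- Stated for F_q-linear maps because the proof of simplicity applies it to a map read off from a
  -- subspace, with no q-polynomial given.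
  linSetEq⇒scaled : ∀ {f} → Linear f → LinSetEq F q n (graph F q n f) V →
    ∃ λ l → l ≢ 0# × (∀ x → l * f x ≡ tr (l * x))
  linSetEq⇒scaled f-linear eq = sameSlopes⇒scaled f-linear (linSetEq⇒sameSlopes eq)

  *-inv-* : ∀ {l} x → l ≢ 0# → l * (inv l * x) ≡ x
  *-inv-* x l≢0 = trans (sym (*-assoc _ _ _)) (trans (cong (_* x) (*-inv l≢0)) (*-identityˡ x))

  inv-*-* : ∀ {l} x → l ≢ 0# → inv l * (l * x) ≡ x
  inv-*-* x l≢0 = trans (sym (*-assoc _ _ _)) (trans (cong (_* x) (inv-* l≢0)) (*-identityˡ x))

  scaledEq⇒linSetEq : ∀ {U V : SubsetW F q n} {l} → l ≢ 0# → ScaledEq F q n l U V → LinSetEq F q n U V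
  scaledEq⇒linSetEq {U} {V} {l} l≢0 (sub , sup) = to , from
    where
    to : LinSetSub F q n U V
    to u@(a , b) u∈ u≢0 = _ , sub u u∈
      , (λ eq → u≢0 (cong₂ _,_ (*≡0 (cong proj₁ eq)) (*≡0 (cong proj₂ eq))))
      , inv l , sym (cong₂ _,_ (inv-*-* a l≢0) (inv-*-* b l≢0))
      where
      *≡0 : ∀ {x} → l * x ≡ 0# → x ≡ 0#
      *≡0 eq = *-cancelˡ l≢0 (trans eq (sym (zeroʳ l)))
    from : LinSetSub F q n V U
    from v v∈ v≢0 with sup v v∈
    ... | u , u∈ , refl = u , u∈ , (λ { refl → v≢0 (cong₂ _,_ (zeroʳ l) (zeroʳ l)) }) , l , refl

  scaled⇒scaledEq : ∀ {f l} → l ≢ 0# → (∀ x → l * f x ≡ tr (l * x)) → ScaledEq F q n l (graph F q n f) V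
  scaled⇒scaledEq {f} {l} l≢0 scaled =
      (λ { _ (x , refl) → l * x , cong (l * x ,_) (scaled x) })
    , (λ { _ (y , refl) → (inv l * y , f (inv l * y)) , (inv l * y , refl)
         , cong₂ _,_ (*-inv-* y l≢0) (trans (scaled (inv l * y)) (cong tr (*-inv-* y l≢0))) })

  V-subspace : IsSubspace F q n 1 V
  V-subspace = (0# , cong (0# ,_) (sym tr-0))
    , (λ { _ _ (x , refl) (y , refl) → x + y , cong (x + y ,_) (sym (tr-+ x y)) })
    , (λ { c _ c∈ (x , refl) → c * x , cong (c * x ,_) (sym (tr-* (inSubfield⇒fixed c∈) x)) })

  -- The point ⟨(0,1)⟩ does not lie on L_V, so U′ projects injectively to the first coordinate.
  same-abscissa : ∀ t {U′ : SubsetW F q n} → IsSubspace F q n t U′ → LinSetSub F q n U′ V →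
    ∀ {x y y′} → U′ (x , y) → U′ (x , y′) → y ≡ y′
  same-abscissa t {U′} (_ , U′-+ , U′-*) sub {x} {y} {y′} p p′ = x-y≡0⇒x≡y y y′ (vertical difference)
    where
    difference : U′ (0# , y - y′)
    difference = subst U′ (cong₂ _,_ (solve 1 (λ x → x :+ (:- con (+ 1)) :* x := con (+ 0)) refl x)
                                     (solve 2 (λ y y′ → y :+ (:- con (+ 1)) :* y′ := y :- y′) refl y y′))
      (U′-+ _ _ p (U′-* (- 1#) _ (fixed⇒inSubfield t (Fqᵗ.fixed-neg t (Fqᵗ.fixed-1 t))) p′))
    vertical : ∀ {y} → U′ (0# , y) → y ≡ 0#
    vertical {y} p with y ≟ 0#
    ... | yes y≡0 = y≡0
    ... | no y≢0 with sub (0# , y) p (y≢0 ∘ cong proj₂)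
    ...   | _ , (a , refl) , _ , μ , eq with a ≟ 0#
    ...     | yes refl = trans (cong proj₂ eq) (trans (cong (μ *_) tr-0) (zeroʳ μ))
    ...     | no a≢0   = trans (cong proj₂ eq) (trans (cong (_* tr a) μ≡0) (zeroˡ _))
      where
      μ≡0 : μ ≡ 0#
      μ≡0 = *-cancelˡ a≢0 (trans (*-comm a μ) (trans (sym (cong proj₁ eq)) (sym (zeroʳ a))))

  -- If U′ were F_{q^t}-linear, with ω ∈ F_{q^t} ∖ F_q, then scaling one vector
  -- on each point ⟨(z,1)⟩, Tr z = 1, by all the Tr x + ω would already exhaust the
  -- first coordinates of U′, leaving no room for the scalar 1.
  not-linear-over : ∀ t {ω} → Fqᵗ.Fixed t ω → ¬ Fq.Fixed ω →
    ∀ {U′ : SubsetW F q n} → IsSubspace F q n t U′ → ¬ LinSetEq F q n U′ V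
  not-linear-over t {ω} ω∈ ω∉ {U′} U′-subspace@(_ , _ , U′-*) (sub , sup) = contradiction fixed-ω ω∉
    where
    open ≡-Reasoning
    witness : ∀ z → tr z ≡ 1# → ∃ λ y → U′ (z * y , y) × y ≢ 0#
    witness z trz≡1 with sup (z , tr z) (z , refl) (λ eq → 0≢1 (trans (sym (cong proj₂ eq)) trz≡1))
    ... | (x , y) , u∈ , _ , μ , eq = y , subst (λ a → U′ (a , y)) x≡ u∈ , *≡1⇒≢0 (trans (*-comm y μ) μy≡1)
      where
      μy≡1 : μ * y ≡ 1#
      μy≡1 = trans (sym (cong proj₂ eq)) trz≡1
      x≡ : x ≡ z * y
      x≡ = begin
        x              ≡⟨ *-identityˡ x ⟨
        1# * x         ≡⟨ cong (_* x) μy≡1 ⟨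
        μ * y * x      ≡⟨ solve 3 (λ μ y x → μ :* y :* x := μ :* x :* y) refl μ y x ⟩
        μ * x * y      ≡⟨ cong (_* y) (cong proj₁ eq) ⟨
        z * y          ∎

    height : Carrier → Carrier
    height z with tr z ≟ 1#
    ... | yes eq = proj₁ (witness z eq)
    ... | no _   = 0#

    height-spec : ∀ z → tr z ≡ 1# → U′ (z * height z , height z) × height z ≢ 0#
    height-spec z trz≡1 with tr z ≟ 1#
    ... | yes eq = proj₂ (witness z eq)
    ... | no neq = contradiction trz≡1 neq

    -- Equal first coordinates in `U′` force equal second coordinates; dividing the first by the
    -- second recovers z, and then c.
    unique : ∀ c c′ z z′ → Fqᵗ.Fixed t c → Fqᵗ.Fixed t c′ → c ≢ 0# → tr z ≡ 1# → tr z′ ≡ 1# →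
      c * (z * height z) ≡ c′ * (z′ * height z′) → z ≡ z′ × c ≡ c′
    unique c c′ z z′ c∈ c′∈ c≢0 trz trz′ eq = z≡z′ , c≡c′
      where
      h≡ : c * height z ≡ c′ * height z′
      h≡ = same-abscissa t U′-subspace sub
        (U′-* c _ (fixed⇒inSubfield t c∈) (proj₁ (height-spec z trz)))
        (subst (λ a → U′ (a , c′ * height z′)) (sym eq) (U′-* c′ _ (fixed⇒inSubfield t c′∈) (proj₁ (height-spec z′ trz′))))
      z≡z′ : z ≡ z′
      z≡z′ = *-cancelˡ (*-≢0 c≢0 (proj₂ (height-spec z trz))) (begin
        c * height z * z           ≡⟨ solve 3 (λ c h z → c :* h :* z := c :* (z :* h)) refl c (height z) z ⟩
        c * (z * height z)         ≡⟨ eq ⟩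
        c′ * (z′ * height z′)      ≡⟨ solve 3 (λ c h z → c :* (z :* h) := c :* h :* z) refl c′ (height z′) z′ ⟩
        c′ * height z′ * z′        ≡⟨ cong (_* z′) h≡ ⟨
        c * height z * z′          ∎)
      c≡c′ : c ≡ c′
      c≡c′ = *-cancelˡ (proj₂ (height-spec z trz)) (begin
        height z * c               ≡⟨ *-comm _ _ ⟩
        c * height z               ≡⟨ h≡ ⟩
        c′ * height z′             ≡⟨ cong (λ w → c′ * height w) z≡z′ ⟨
        c′ * height z              ≡⟨ *-comm _ _ ⟩
        height z * c′              ∎)

    -- The coset F_q + ω consists of nonzero elements of F_{q^t} and does not contain 1.
    scalar : Carrier → Carrier
    scalar x = tr x + ω

    -- Moves x along `unit` into {tr = 1}. Together with tr x it determines x, so the pairs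
    -- (`affine x`, `scalar x`) are as many as the elements of F.
    affine : Carrier → Carrier
    affine x = x + (1# - tr x) * unit

    scalar∈ : ∀ x → Fqᵗ.Fixed t (scalar x)
    scalar∈ x = Fqᵗ.fixed-+ t (Fq⊆Fqᵗ t (tr-fixed x)) ω∈

    scalar≢0 : ∀ x → scalar x ≢ 0#
    scalar≢0 x eq = ω∉ (subst Fq.Fixed
      (trans (cong (λ s → s - tr x) (sym eq)) (solve 2 (λ t ω → t :+ ω :- t := ω) refl (tr x) ω))
      (Fq.fixed-+ Fq.fixed-0 (Fq.fixed-neg (tr-fixed x))))

    tr-affine : ∀ x → tr (affine x) ≡ 1#
    tr-affine x = begin
      tr (x + (1# - tr x) * unit)          ≡⟨ tr-+ _ _ ⟩
      tr x + tr ((1# - tr x) * unit)       ≡⟨ cong (λ s → tr x + s) (tr-* (Fq.fixed-+ Fq.fixed-1 (Fq.fixed-neg (tr-fixed x))) unit) ⟩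
      tr x + (1# - tr x) * tr unit         ≡⟨ cong (λ s → tr x + (1# - tr x) * s) T-unit ⟩
      tr x + (1# - tr x) * 1#              ≡⟨ solve 1 (λ s → s :+ (con (+ 1) :- s) :* con (+ 1) := con (+ 1)) refl (tr x) ⟩
      1#                                   ∎

    +-cancel : ∀ x y → x + y - y ≡ x
    +-cancel = solve 2 (λ x y → x :+ y :- y := x) refl

    affine-cancel : ∀ x → affine x - (1# - tr x) * unit ≡ x
    affine-cancel x = +-cancel x ((1# - tr x) * unit)

    Ψ : Carrier → Carrier
    Ψ x = scalar x * (affine x * height (affine x))

    Ψ-injective : ∀ x x′ → Ψ x ≡ Ψ x′ → x ≡ x′
    Ψ-injective x x′ eq = trans (sym (affine-cancel x)) (trans (cong₂ (λ z s → z - (1# - s) * unit) (proj₁ same) tr≡) (affine-cancel x′))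
      where
      same : affine x ≡ affine x′ × scalar x ≡ scalar x′
      same = unique (scalar x) (scalar x′) (affine x) (affine x′) (scalar∈ x) (scalar∈ x′) (scalar≢0 x) (tr-affine x) (tr-affine x′) eq
      tr≡ : tr x ≡ tr x′
      tr≡ = trans (sym (+-cancel (tr x) ω)) (trans (cong (λ s → s - ω) (proj₂ same)) (+-cancel (tr x′) ω))

    fixed-ω : Fq.Fixed ω
    fixed-ω = subst Fq.Fixed
      (trans (cong (λ s → s - tr x) (sym scalar≡1)) (trans (cong (λ s → s - tr x) (+-comm (tr x) ω)) (+-cancel ω (tr x))))
      (Fq.fixed-+ Fq.fixed-1 (Fq.fixed-neg (tr-fixed x)))
      where
      preimage : ∃ λ x → Ψ x ≡ 1# * (unit * height unit)
      -- The target is the first coordinate belonging to the scalar 1. Being a value of `Ψ`, it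
      -- forces tr x + ω = 1 by `unique`, which puts ω in F_q.
      preimage = injective⇒surjective Ψ Ψ-injective (1# * (unit * height unit))
      x : Carrier
      x = proj₁ preimage
      scalar≡1 : scalar x ≡ 1#
      scalar≡1 = proj₂ (unique (scalar x) 1# (affine x) unit (scalar∈ x) (Fqᵗ.fixed-1 t) (scalar≢0 x) (tr-affine x) T-unit (proj₂ preimage))

  V-maxField : MaxFieldFq F q n V
  V-maxField t 1<t t∣n (U′ , U′-subspace , eq) with ω , ω∈ , ω∉ ← proper-extension t 1<t t∣n =
    not-linear-over t ω∈ ω∉ U′-subspace eq

  lincomb-cong : ∀ d {c c′ : Fin d → Carrier} b → (∀ i → c i ≡ c′ i) → lincomb F q n d c b ≡ lincomb F q n d c′ b
  lincomb-cong zero    b eq = refl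
  lincomb-cong (suc d) b eq = cong₂ (_⊕_ F q n) (cong (λ s → _•_ F q n s (b zero)) (eq zero)) (lincomb-cong d (b ∘ suc) (eq ∘ suc))

  lincomb-sub : ∀ d (c c′ : Fin d → Carrier) b → lincomb F q n d c b ≡ lincomb F q n d c′ b →
    lincomb F q n d (λ i → c i - c′ i) b ≡ 0W F q n
  lincomb-sub d c c′ b eq = cong₂ _,_
    (trans (first d c c′ b) (trans (cong (λ w → proj₁ w - proj₁ (lincomb F q n d c′ b)) eq) (-‿inverseʳ _)))
    (trans (second d c c′ b) (trans (cong (λ w → proj₂ w - proj₂ (lincomb F q n d c′ b)) eq) (-‿inverseʳ _)))
    where
    distribute : ∀ c c′ x s s′ → (c - c′) * x + (s - s′) ≡ c * x + s - (c′ * x + s′)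
    distribute = solve 5 (λ c c′ x s s′ → (c :- c′) :* x :+ (s :- s′) := c :* x :+ s :- (c′ :* x :+ s′)) refl
    first : ∀ d c c′ b → proj₁ (lincomb F q n d (λ i → c i - c′ i) b) ≡ proj₁ (lincomb F q n d c b) - proj₁ (lincomb F q n d c′ b)
    first zero    c c′ b = sym (-‿inverseʳ 0#)
    first (suc d) c c′ b = trans (cong (λ s → (c zero - c′ zero) * proj₁ (b zero) + s) (first d (c ∘ suc) (c′ ∘ suc) (b ∘ suc)))
      (distribute _ _ _ _ _)
    second : ∀ d c c′ b → proj₂ (lincomb F q n d (λ i → c i - c′ i) b) ≡ proj₂ (lincomb F q n d c b) - proj₂ (lincomb F q n d c′ b)
    second zero    c c′ b = sym (-‿inverseʳ 0#)
    second (suc d) c c′ b = trans (cong (λ s → (c zero - c′ zero) * proj₂ (b zero) + s) (second d (c ∘ suc) (c′ ∘ suc) (b ∘ suc)))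
      (distribute _ _ _ _ _)

  lincomb∈ : ∀ {U} → IsSubspace F q n 1 U → ∀ d (c : Fin d → Carrier) b → (∀ i → InSubfield F q n 1 (c i)) →
    (∀ i → U (b i)) → U (lincomb F q n d c b)
  lincomb∈ (U-0 , _) zero c b c∈ b∈ = U-0
  lincomb∈ U-subspace@(_ , U-+ , U-*) (suc d) c b c∈ b∈ =
    U-+ _ _ (U-* _ _ (c∈ zero) (b∈ zero)) (lincomb∈ U-subspace d (c ∘ suc) (b ∘ suc) (c∈ ∘ suc) (b∈ ∘ suc))

  -- A subspace of the dimension of V is as large as F, so its injective
  -- projection to the first coordinate is a bijection.
  is-graph : ∀ {U k} → IsSubspace F q n 1 U → HasDim F q n U k → HasDim F q n V k → LinSetSub F q n U V →
    ∃ λ f → Linear f × (∀ x → U (x , f x)) × (∀ {x y} → U (x , y) → y ≡ f x)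
  is-graph {U} {k} U-subspace@(_ , U-+ , U-*) (b′ , b′∈ , ind′ , _) (b , _ , _ , spans) sub =
    f , record { f-+ = f-+ ; f-* = f-* } , f∈ , (λ p → same-abscissa 1 U-subspace sub p (f∈ _))
    where
    coords : Carrier → Fin k → Carrier
    coords x = proj₁ (spans (x , tr x) (x , refl))
    coords∈ : ∀ x i → InSubfield F q n 1 (coords x i)
    coords∈ x = proj₁ (proj₂ (spans (x , tr x) (x , refl)))
    coords≡ : ∀ x → (x , tr x) ≡ lincomb F q n k (coords x) b
    coords≡ x = proj₂ (proj₂ (spans (x , tr x) (x , refl)))
    -- Transports (x, tr x) to the vector of `U` with the same coordinates. Its abscissa fixes that
    -- vector, and independence of `b′` then fixes the coordinates, so x is recovered.
    image : Carrier → W F q n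
    image x = lincomb F q n k (coords x) b′
    image∈ : ∀ x → U (image x)
    image∈ x = lincomb∈ U-subspace k (coords x) b′ (coords∈ x) b′∈
    image-injective : ∀ x y → proj₁ (image x) ≡ proj₁ (image y) → x ≡ y
    image-injective x y eq = cong proj₁ (trans (coords≡ x) (trans (lincomb-cong k b coords-eq) (sym (coords≡ y))))
      where
      image≡ : image x ≡ image y
      image≡ = cong₂ _,_ eq (same-abscissa 1 U-subspace sub (image∈ x) (subst (λ a → U (a , proj₂ (image y))) (sym eq) (image∈ y)))
      coords-eq : ∀ i → coords x i ≡ coords y i
      coords-eq i = x-y≡0⇒x≡y _ _ (ind′ (λ i → coords x i - coords y i)
        (λ i → fixed⇒inSubfield₁ (Fq.fixed-+ (inSubfield⇒fixed (coords∈ x i)) (Fq.fixed-neg (inSubfield⇒fixed (coords∈ y i)))))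
        (lincomb-sub k (coords x) (coords y) b′ image≡) i)
    surjective : ∀ x → ∃ λ y → proj₁ (image y) ≡ x
    surjective = injective⇒surjective (λ x → proj₁ (image x)) image-injective
    f : Carrier → Carrier
    f x = proj₂ (image (proj₁ (surjective x)))
    f∈ : ∀ x → U (x , f x)
    f∈ x = subst (λ a → U (a , f x)) (proj₂ (surjective x)) (image∈ (proj₁ (surjective x)))
    f-+ : ∀ x y → f (x + y) ≡ f x + f y
    f-+ x y = same-abscissa 1 U-subspace sub (f∈ (x + y)) (U-+ _ _ (f∈ x) (f∈ y))
    f-* : ∀ {c} → Fq.Fixed c → ∀ x → f (c * x) ≡ c * f x
    f-* c∈ x = same-abscissa 1 U-subspace sub (f∈ _) (U-* _ _ (fixed⇒inSubfield₁ c∈) (f∈ x))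

  -- The hypothesis says l · U = V, so the scalar matrix `inv l`, with the identity automorphism,
  -- carries V to U.
  scaled⇒equivalent : ∀ {U : SubsetW F q n} {f : Carrier → Carrier} {l} → l ≢ 0# → (∀ x → l * f x ≡ tr (l * x)) →
    (∀ x → U (x , f x)) → (∀ {x y} → U (x , y) → y ≡ f x) → Σ (ΓL F q n) λ g → ImageEq F q n g V U
  scaled⇒equivalent {U} {f} {l} l≢0 scaled f∈ f-unique = g , to , from
    where
    diagonal : ∀ x y → (inv l * x + 0# * y , 0# * x + inv l * y) ≡ (inv l * x , inv l * y)
    diagonal x y = cong₂ _,_ (solve 3 (λ i x y → i :* x :+ con (+ 0) :* y := i :* x) refl (inv l) x y)
                             (solve 3 (λ i x y → con (+ 0) :* x :+ i :* y := i :* y) refl (inv l) x y)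
    g : ΓL F q n
    g = record
      { σ     = id
      ; σ-aut = (λ _ _ → refl) , (λ _ _ → refl) , refl , (λ _ _ eq → eq) , (λ y → y , refl)
      ; a = inv l ; b = 0# ; c = 0# ; d = inv l
      ; det≢0 = λ eq → *-≢0 (inv-≢0 l≢0) (inv-≢0 l≢0)
          (trans (solve 1 (λ i → i :* i := i :* i :- con (+ 0) :* con (+ 0)) refl (inv l)) eq)
      }
    to : ∀ u → V u → U (applyΓL F q n g u)
    to _ (x , refl) = subst U (sym (trans (diagonal x (tr x)) (cong (inv l * x ,_) (sym f≡)))) (f∈ (inv l * x))
      where
      f≡ : f (inv l * x) ≡ inv l * tr x
      f≡ = *-cancelˡ l≢0 (trans (scaled _) (trans (cong tr (*-inv-* x l≢0)) (sym (*-inv-* (tr x) l≢0))))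
    from : ∀ v → U v → Σ (W F q n) λ u → V u × applyΓL F q n g u ≡ v
    from (x , y) v∈ = (l * x , tr (l * x)) , (l * x , refl) , trans (diagonal _ _)
      (cong₂ _,_ (inv-*-* x l≢0) (trans (cong (inv l *_) (sym (scaled x))) (trans (inv-*-* (f x) l≢0) (sym (f-unique v∈)))))

  V-simple : IsSimple F q n V
  V-simple = V-subspace , V-maxField , equivalent
    where
    equivalent : ∀ U k → IsSubspace F q n 1 U → HasDim F q n U k → HasDim F q n V k → LinSetEq F q n U V →
      Σ (ΓL F q n) λ g → ImageEq F q n g V U
    equivalent U k U-subspace U-dim V-dim (sub , sup) = graph-case (is-graph U-subspace U-dim V-dim sub)
      where
      graph-case : (∃ λ f → Linear f × (∀ x → U (x , f x)) × (∀ {x y} → U (x , y) → y ≡ f x)) →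
        Σ (ΓL F q n) λ g → ImageEq F q n g V U
      graph-case (f , f-linear , f∈ , f-unique) = scaled-case (linSetEq⇒scaled f-linear (graph-sub , graph-sup))
        where
        graph-sub : LinSetSub F q n (graph F q n f) V
        graph-sub _ (x , refl) = sub (x , f x) (f∈ x)
        graph-sup : LinSetSub F q n V (graph F q n f)
        graph-sup v v∈ v≢0 with u , u∈ , rest ← sup v v∈ v≢0 = u , (proj₁ u , cong (proj₁ u ,_) (f-unique u∈)) , rest
        scaled-case : (∃ λ l → l ≢ 0# × (∀ x → l * f x ≡ tr (l * x))) → Σ (ΓL F q n) λ g → ImageEq F q n g V U
        scaled-case (l , l≢0 , scaled) = scaled⇒equivalent l≢0 scaled f∈ f-unique

theorem3p7 : (F : FiniteField) (q n : ℕ) → IsPrimePower q → 2 ≤ n → FiniteField.card F ≡ q ℕ.^ n →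
    ((a : Fin n → FiniteField.Carrier F) →
    LinSetEq F q n (graph F q n (evalQPoly F q n a)) (graph F q n (Tr F q n))
    ⇔ Σ (FiniteField.Carrier F) (λ μ → μ ≢ FiniteField.0# F
    × ScaledEq F q n μ (graph F q n (evalQPoly F q n a)) (graph F q n (Tr F q n))))
    × IsSimple F q n (graph F q n (Tr F q n))
theorem3p7 F q n q-primePower 2≤n card≡ =
  (λ a → mk⇔ (λ eq → let l , l≢0 , scaled = linSetEq⇒scaled (qPoly-linear a) eq in l , l≢0 , scaled⇒scaledEq l≢0 scaled)
             (λ (l , l≢0 , eq) → scaledEq⇒linSetEq l≢0 eq)) , V-simple
  where open LinearSets F q n q-primePower 2≤n card≡
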